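{- Let $r\in\mathbb{Z}$, $s\in\mathbb{N}$ be coprime with $|r|<s$, let $\theta=\arccos(r/s)$, and let $k\in\mathbb{N}$ be squarefree. Let $E$ be the elliptic curve $y^2=x\bigl(x-(s-r)k\bigr)\bigl(x+(s+r)k\bigr)$ over $\mathbb{Q}$ associated with $(r,s,k)$. (i) If $k$ is odd and $E(\mathbb{Q})$ has a point of order $4$ or $8$, then $k=1$. (ii) If $k$ is even and $E(\mathbb{Q})$ has a point of order $4$ or $8$, then $k=2$. (iii) If $k$ is odd and $E(\mathbb{Q})$ has a point of order $3$ or $6$, then $k\in\{1,3\}$. (iv) If $k$ is even and $E(\mathbb{Q})$ has a point of order $3$ or $6$, then $k\in\{2,6\}$.
   Context: Given $\theta\in(0,\pi)$ with $\cos\theta=r/s$ in lowest terms, $k\in\mathbb{N}$ is $\theta$-congruent if there is a triangle with rational sides having angle $\theta$ and area $k\sqrt{s^2-r^2}$; this holds iff $E(\mathbb{Q})$ has a point of order $>2$, and $k$ is said to be $\theta$-congruent due to $N$-torsion when $E(\mathbb{Q})$ has a point of order $N$ (which then yields such a triangle). -}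

module Defs where

open import Algebra.Bundles.Raw using (RawMonoid)
import Algebra.Definitions.RawMonoid as RawMonoidDefinitions
open import Data.Integer.Base as ℤ using (ℤ)
open import Data.Nat.Base as ℕ using (ℕ)
import Data.Nat.Divisibility as ℕ
open import Data.Product.Base using (_×_; ∃-syntax)
open import Data.Rational.Base using (ℚ; 0ℚ; _+_; _*_; _-_; -_; _÷_; _/_; 1/_; NonZero; ≢-nonZero)
open import Data.Rational.Properties using (_≟_; *-assoc; *-comm; *-inverseˡ; *-inverseʳ; *-identityʳ; *-zeroʳ; +-identityʳ; +-identityˡ; +-inverseʳ)
open import Data.Rational.Solver using (module +-*-Solver)
open import Level using (0ℓ)
open import Relation.Binary.PropositionalEquality
open import Relation.Nullary using (¬_; yes; no)

Squarefree : ℕ → Set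
Squarefree n = ∀ d → (d ℕ.* d) ℕ.∣ n → d ≡ 1

module _ (M : RawMonoid 0ℓ 0ℓ) where
  open RawMonoid M using (Carrier; _≈_; ε)
  open RawMonoidDefinitions M using () renaming (_×_ to _·_)

  HasOrder : Carrier → ℕ → Set
  HasOrder x n = 0 ℕ.< n × (n · x) ≈ ε × (∀ m → 0 ℕ.< m → m ℕ.< n → ¬ (m · x) ≈ ε)

  HasElementOfOrder : ℕ → Set
  HasElementOfOrder n = ∃[ x ] HasOrder x n

private
  p-q≡0⇒p≡q : ∀ p q → p - q ≡ 0ℚ → p ≡ q
  p-q≡0⇒p≡q p q eq = begin
    p            ≡⟨ solve 2 (λ p q → p := (p :- q) :+ q) refl p q ⟩
    (p - q) + q  ≡⟨ cong (_+ q) eq ⟩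
    0ℚ + q       ≡⟨ +-identityˡ q ⟩
    q            ∎
    where
    open ≡-Reasoning
    open +-*-Solver

  p+q≡0⇒p≡-q : ∀ p q → p + q ≡ 0ℚ → p ≡ - q
  p+q≡0⇒p≡-q p q eq = p-q≡0⇒p≡q p (- q)
    (trans (solve 2 (λ p q → p :- (:- q) := p :+ q) refl p q) eq)
    where open +-*-Solver

  ÷-*-cancel : ∀ p q .{{_ : NonZero q}} → (p ÷ q) * q ≡ p
  ÷-*-cancel p q = trans (*-assoc p (1/ q) q)
    (trans (cong (p *_) (*-inverseˡ q)) (*-identityʳ p))

  p*q≡0⇒q≡0 : ∀ p q .{{_ : NonZero p}} → p * q ≡ 0ℚ → q ≡ 0ℚ
  p*q≡0⇒q≡0 p q eq = begin
    q               ≡⟨ *-identityʳ q ⟨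
    q * _           ≡⟨ cong (q *_) (*-inverseʳ p) ⟨
    q * (p * 1/ p)  ≡⟨ solve 3 (λ p q i → q :* (p :* i) := (p :* q) :* i) refl p q (1/ p) ⟩
    (p * q) * 1/ p  ≡⟨ cong (_* 1/ p) eq ⟩
    0ℚ * 1/ p       ≡⟨ *-comm 0ℚ (1/ p) ⟩
    1/ p * 0ℚ       ≡⟨ *-zeroʳ (1/ p) ⟩
    0ℚ              ∎
    where
    open ≡-Reasoning
    open +-*-Solver

-- The curve y² = x (x - α) (x + β) over ℚ with the chord-and-tangent addition.
module Curve (α β : ℚ) where

  cubic : ℚ → ℚ
  cubic x = x * (x - α) * (x + β)

  cubic′ : ℚ → ℚ
  cubic′ x = (x - α) * (x + β) + x * (x + β) + x * (x - α)

  OnCurve : ℚ → ℚ → Set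
  OnCurve x y = y * y ≡ cubic x

  -- The equation is irrelevant, so affine points with equal coordinates are equal.
  data Point : Set where
    O   : Point
    aff : (x y : ℚ) → .(OnCurve x y) → Point

  -- A line of slope l through points of abscissae x₁ and x₂ meets the curve
  -- again at abscissa x₃ with x₁ + x₂ + x₃ = l² - (β - α); the sum of the two
  -- points is the reflection of that third point in the x-axis.
  sumX : (l x₁ x₂ : ℚ) → ℚ
  sumX l x₁ x₂ = l * l - (β - α) - x₁ - x₂

  sumY : (l x₁ y₁ x₂ : ℚ) → ℚ
  sumY l x₁ y₁ x₂ = l * (x₁ - sumX l x₁ x₂) - y₁

  private
    -- The divided difference of cubic x - (y₁ + l (x - x₁))² at x₁ and x₂.
    residue : (l x₁ y₁ x₂ : ℚ) → ℚ
    residue l x₁ y₁ x₂ =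
      x₂ * x₂ + x₂ * x₁ + x₁ * x₁ + (β - α) * (x₂ + x₁) - α * β
        - (l * y₁ + l * y₁) - l * l * (x₂ - x₁)

    sum-equation : ∀ l x₁ y₁ x₂ →
      cubic (sumX l x₁ x₂) ≡
      sumY l x₁ y₁ x₂ * sumY l x₁ y₁ x₂
        + ((cubic x₁ - y₁ * y₁) + (sumX l x₁ x₂ - x₁) * residue l x₁ y₁ x₂)
    sum-equation l x₁ y₁ x₂ = solve 6
      (λ α β l x₁ y₁ x₂ →
        let x₃ = l :* l :- (β :- α) :- x₁ :- x₂
            y₃ = l :* (x₁ :- x₃) :- y₁
            cubic x = x :* (x :- α) :* (x :+ β)
            res = x₂ :* x₂ :+ x₂ :* x₁ :+ x₁ :* x₁ :+ (β :- α) :* (x₂ :+ x₁) :- α :* β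
                    :- (l :* y₁ :+ l :* y₁) :- l :* l :* (x₂ :- x₁)
        in cubic x₃ := y₃ :* y₃ :+ ((cubic x₁ :- y₁ :* y₁) :+ (x₃ :- x₁) :* res))
      refl α β l x₁ y₁ x₂
      where open +-*-Solver

    sum-onCurve : ∀ l x₁ y₁ x₂ → OnCurve x₁ y₁ → residue l x₁ y₁ x₂ ≡ 0ℚ →
      OnCurve (sumX l x₁ x₂) (sumY l x₁ y₁ x₂)
    sum-onCurve l x₁ y₁ x₂ e res≡0 = sym (begin
      cubic x₃                                                     ≡⟨ sum-equation l x₁ y₁ x₂ ⟩
      y₃ * y₃ + ((cubic x₁ - y₁ * y₁) + (x₃ - x₁) * residue l x₁ y₁ x₂)
        ≡⟨ cong₂ (λ u v → y₃ * y₃ + ((cubic x₁ - u) + (x₃ - x₁) * v)) e res≡0 ⟩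
      y₃ * y₃ + ((cubic x₁ - cubic x₁) + (x₃ - x₁) * 0ℚ)
        ≡⟨ cong₂ (λ u v → y₃ * y₃ + (u + v)) (+-inverseʳ (cubic x₁)) (*-zeroʳ (x₃ - x₁)) ⟩
      y₃ * y₃ + (0ℚ + 0ℚ)                                          ≡⟨ +-identityʳ (y₃ * y₃) ⟩
      y₃ * y₃                                                      ∎)
      where
      open ≡-Reasoning
      x₃ = sumX l x₁ x₂
      y₃ = sumY l x₁ y₁ x₂

  chordSlope : (x₁ y₁ x₂ y₂ : ℚ) → x₁ ≢ x₂ → ℚ
  chordSlope x₁ y₁ x₂ y₂ x₁≢x₂ =
    _÷_ (y₂ - y₁) (x₂ - x₁) {{≢-nonZero (λ eq → x₁≢x₂ (sym (p-q≡0⇒p≡q x₂ x₁ eq)))}}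

  -- Used only when (x₁ , y₁) and (x₁ , y₂) both lie on the curve; then y₁ ≢ - y₂
  -- forces y₁ ≡ y₂, and the denominator is 2 y₁.
  tangentSlope : (x₁ y₁ y₂ : ℚ) → y₁ ≢ - y₂ → ℚ
  tangentSlope x₁ y₁ y₂ y₁≢-y₂ =
    _÷_ (cubic′ x₁) (y₁ + y₂) {{≢-nonZero (λ eq → y₁≢-y₂ (p+q≡0⇒p≡-q y₁ y₂ eq))}}

  chord-onCurve : ∀ x₁ y₁ x₂ y₂ (x₁≢x₂ : x₁ ≢ x₂) → OnCurve x₁ y₁ → OnCurve x₂ y₂ →
    let l = chordSlope x₁ y₁ x₂ y₂ x₁≢x₂ in OnCurve (sumX l x₁ x₂) (sumY l x₁ y₁ x₂)
  chord-onCurve x₁ y₁ x₂ y₂ x₁≢x₂ e₁ e₂ = sum-onCurve l x₁ y₁ x₂ e₁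
    (p*q≡0⇒q≡0 (x₂ - x₁) _ (begin
      (x₂ - x₁) * residue l x₁ y₁ x₂
        ≡⟨ solve 6 (λ α β l x₁ y₁ x₂ →
             let cubic x = x :* (x :- α) :* (x :+ β)
                 res = x₂ :* x₂ :+ x₂ :* x₁ :+ x₁ :* x₁ :+ (β :- α) :* (x₂ :+ x₁) :- α :* β
                         :- (l :* y₁ :+ l :* y₁) :- l :* l :* (x₂ :- x₁)
                 h = l :* (x₂ :- x₁)
             in (x₂ :- x₁) :* res := (cubic x₂ :- (y₁ :+ h) :* (y₁ :+ h)) :- (cubic x₁ :- y₁ :* y₁))
           refl α β l x₁ y₁ x₂ ⟩
      (cubic x₂ - (y₁ + l * (x₂ - x₁)) * (y₁ + l * (x₂ - x₁))) - (cubic x₁ - y₁ * y₁)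
        ≡⟨ cong (λ h → (cubic x₂ - (y₁ + h) * (y₁ + h)) - (cubic x₁ - y₁ * y₁))
             (÷-*-cancel (y₂ - y₁) (x₂ - x₁)) ⟩
      (cubic x₂ - (y₁ + (y₂ - y₁)) * (y₁ + (y₂ - y₁))) - (cubic x₁ - y₁ * y₁)
        ≡⟨ cong₂ (λ u v → (u - (y₁ + (y₂ - y₁)) * (y₁ + (y₂ - y₁))) - (v - y₁ * y₁)) (sym e₂) (sym e₁) ⟩
      (y₂ * y₂ - (y₁ + (y₂ - y₁)) * (y₁ + (y₂ - y₁))) - (y₁ * y₁ - y₁ * y₁)
        ≡⟨ solve 2 (λ y₁ y₂ →
             (y₂ :* y₂ :- (y₁ :+ (y₂ :- y₁)) :* (y₁ :+ (y₂ :- y₁))) :- (y₁ :* y₁ :- y₁ :* y₁)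
               := con 0ℚ) refl y₁ y₂ ⟩
      0ℚ ∎))
    where
    open ≡-Reasoning
    open +-*-Solver
    instance
      x₂-x₁≢0 : NonZero (x₂ - x₁)
      x₂-x₁≢0 = ≢-nonZero (λ eq → x₁≢x₂ (sym (p-q≡0⇒p≡q x₂ x₁ eq)))
    l = chordSlope x₁ y₁ x₂ y₂ x₁≢x₂

  tangent-onCurve : ∀ x₁ y₁ x₂ y₂ → x₁ ≡ x₂ → (y₁≢-y₂ : y₁ ≢ - y₂) → OnCurve x₁ y₁ → OnCurve x₂ y₂ →
    let l = tangentSlope x₁ y₁ y₂ y₁≢-y₂ in OnCurve (sumX l x₁ x₂) (sumY l x₁ y₁ x₂)
  tangent-onCurve x₁ y₁ _ y₂ refl y₁≢-y₂ e₁ e₂ = sum-onCurve l x₁ y₁ x₁ e₁ (begin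
      residue l x₁ y₁ x₁
        ≡⟨ solve 5 (λ α β l x₁ y₁ →
             x₁ :* x₁ :+ x₁ :* x₁ :+ x₁ :* x₁ :+ (β :- α) :* (x₁ :+ x₁) :- α :* β
               :- (l :* y₁ :+ l :* y₁) :- l :* l :* (x₁ :- x₁)
             := ((x₁ :- α) :* (x₁ :+ β) :+ x₁ :* (x₁ :+ β) :+ x₁ :* (x₁ :- α)) :- l :* (y₁ :+ y₁))
           refl α β l x₁ y₁ ⟩
      cubic′ x₁ - l * (y₁ + y₁)  ≡⟨ cong (λ y → cubic′ x₁ - l * (y₁ + y)) y₁≡y₂ ⟩
      cubic′ x₁ - l * (y₁ + y₂)  ≡⟨ cong (λ u → cubic′ x₁ - u) (÷-*-cancel (cubic′ x₁) (y₁ + y₂)) ⟩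
      cubic′ x₁ - cubic′ x₁      ≡⟨ +-inverseʳ (cubic′ x₁) ⟩
      0ℚ                         ∎)
    where
    open ≡-Reasoning
    open +-*-Solver
    instance
      y₁+y₂≢0 : NonZero (y₁ + y₂)
      y₁+y₂≢0 = ≢-nonZero (λ eq → y₁≢-y₂ (p+q≡0⇒p≡-q y₁ y₂ eq))
    l = tangentSlope x₁ y₁ y₂ y₁≢-y₂
    y₁≡y₂ : y₁ ≡ y₂
    y₁≡y₂ = p-q≡0⇒p≡q y₁ y₂ (p*q≡0⇒q≡0 (y₁ + y₂) (y₁ - y₂) (begin
      (y₁ + y₂) * (y₁ - y₂)  ≡⟨ solve 2 (λ a b → (a :+ b) :* (a :- b) := a :* a :- b :* b) refl y₁ y₂ ⟩
      y₁ * y₁ - y₂ * y₂      ≡⟨ cong₂ _-_ e₁ e₂ ⟩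
      cubic x₁ - cubic x₁    ≡⟨ +-inverseʳ (cubic x₁) ⟩
      0ℚ                     ∎))

  infixl 6 _⊕_

  _⊕_ : Point → Point → Point
  O            ⊕ Q            = Q
  aff x₁ y₁ e₁ ⊕ O            = aff x₁ y₁ e₁
  aff x₁ y₁ e₁ ⊕ aff x₂ y₂ e₂ with x₁ ≟ x₂ | y₁ ≟ - y₂
  ... | no x₁≢x₂  | _         =
    let l = chordSlope x₁ y₁ x₂ y₂ x₁≢x₂ in
    aff (sumX l x₁ x₂) (sumY l x₁ y₁ x₂) (chord-onCurve x₁ y₁ x₂ y₂ x₁≢x₂ e₁ e₂)
  ... | yes x₁≡x₂ | yes _     = O
  ... | yes x₁≡x₂ | no y₁≢-y₂ =
    let l = tangentSlope x₁ y₁ y₂ y₁≢-y₂ in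
    aff (sumX l x₁ x₂) (sumY l x₁ y₁ x₂) (tangent-onCurve x₁ y₁ x₂ y₂ x₁≡x₂ y₁≢-y₂ e₁ e₂)

  rawMonoid : RawMonoid 0ℓ 0ℓ
  rawMonoid = record { Carrier = Point ; _≈_ = _≡_ ; _∙_ = _⊕_ ; ε = O }

-- E(ℚ) for E : y² = x (x - (s - r) k) (x + (s + r) k).
E⟨ℚ⟩ : (r : ℤ) (s k : ℕ) → RawMonoid 0ℓ 0ℓ
E⟨ℚ⟩ r s k = Curve.rawMonoid
  (((ℤ.+ s ℤ.- r) ℤ.* ℤ.+ k) / 1)
  (((ℤ.+ s ℤ.+ r) ℤ.* ℤ.+ k) / 1)

{-# OPTIONS --safe #-}
-- Cancelling P from both sides of a vanishing multiple 2m P = O shows that m P is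
-- its own negative, hence a rational root (e , 0) of the cubic; no associativity is
-- needed beyond ⊖ P ⊕ (P ⊕ Q) = Q.  With x = e + u the curve is y² = u (u + a) (u + b).
--
-- Orders 4 and 8: some point has v² = ab, and then v + v + a + b = w² is a square,
-- so a w² = (a + v)² and b w² = (b + v)².  Positivity leaves only e = (s - r) k, and
-- (s - r) k and 2 s k are rational squares.  Comparing gcds, k times
-- gcd (s - r , 2 s), a divisor of 2, is a square.
--
-- Orders 3 and 6: x (2P) - e is a square for each root e, say p², q², t², and the
-- torsion condition becomes ± 1/p ± 1/q ± 1/t = 0.  After choosing signs so that
-- pq + qt + tp = 0, (q + t)² (s - r) k = - q³ (q + 2t) and
-- (q + t)² (s + r) k = t³ (t + 2q).  For coprime integers q, t the gcd of the right
-- hand sides divides 3, so k times a divisor of 6 is a square.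
module Submission where

open import Defs
open import Data.Nat.Base using (ℕ; zero; suc)
open import Data.Product.Base using (_×_; _,_; ∃-syntax; proj₁; proj₂)
open import Data.Sum.Base as Sum using (_⊎_; inj₁; inj₂; [_,_]′)
open import Function.Base using (_∘_; id)
open import Relation.Binary.PropositionalEquality
open import Relation.Nullary using (¬_; yes; no; contradiction; recompute)
open import Relation.Nullary.Decidable using (from-yes; from-no)

-- Squarefree naturals and squares.

module _ where
  open import Data.Nat.Base using (_*_; _≤_; ≢-nonZero; s≤s; z≤n)
  open import Data.Nat.Coprimality using (Coprime; coprime-divisor; coprime-/gcd; coprime⇒gcd≡1) renaming (sym to coprime-sym)
  open import Data.Nat.Divisibility
  open import Data.Nat.DivMod using (_/_; m/n*n≡m)
  open import Data.Nat.GCD using (gcd; gcd[m,n]∣m; gcd[m,n]∣n; gcd[m,n]≢0; c*gcd[m,n]≡gcd[cm,cn])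
  open import Data.Nat.Properties
  open import Data.Nat.Solver using (module +-*-Solver)
  open +-*-Solver

  coprime-*ʳ : ∀ {m n o} → Coprime m n → Coprime m o → Coprime m (n * o)
  coprime-*ʳ {m} {n} {o} c c′ {d} (d∣m , d∣no) = c′ (d∣m , coprime-divisor {d} {n} {o}
    (λ (x∣d , x∣n) → c (∣-trans x∣d d∣m , x∣n)) d∣no)

  coprime-squares : ∀ {m n} → Coprime m n → Coprime (m * m) (n * n)
  coprime-squares {m} {n} c = coprime-sym {n * n} (coprime-*ʳ {n * n} n²⊥m n²⊥m)
    where
    n²⊥m : Coprime (n * n) m
    n²⊥m = coprime-sym {m} (coprime-*ʳ {m} c c)

  coprimeParts : ∀ m n → m ≢ 0 → ∃[ g ] ∃[ m′ ] ∃[ n′ ]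
    m ≡ m′ * g × n ≡ n′ * g × Coprime m′ n′ × g ≢ 0
  coprimeParts m n m≢0 = gcd m n , m / gcd m n , n / gcd m n ,
      sym (m/n*n≡m (gcd[m,n]∣m m n)) , sym (m/n*n≡m (gcd[m,n]∣n m n)) , coprime-/gcd m n , g≢0
    where
    g≢0 : gcd m n ≢ 0
    g≢0 = gcd[m,n]≢0 m n (inj₁ m≢0)
    instance _ = ≢-nonZero g≢0

  squarefree⇒≢0 : ∀ {k} → Squarefree k → k ≢ 0
  squarefree⇒≢0 sf refl with () ← sf 2 (4 ∣0)

  squarefree-∣ : ∀ {m n} → m ∣ n → Squarefree n → Squarefree m
  squarefree-∣ m∣n sf d d²∣m = sf d (∣-trans d²∣m m∣n)

  squarefree-6 : Squarefree 6
  squarefree-6 0 d∣6 with () ← 0∣⇒≡0 d∣6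
  squarefree-6 1 d∣6 = refl
  squarefree-6 2 d∣6 = contradiction d∣6 (from-no (4 ∣? 6))
  squarefree-6 d@(suc (suc (suc e))) d∣6 = contradiction (∣⇒≤ d∣6)
    (<⇒≱ (≤-trans (from-yes (7 ≤? 9)) (*-mono-≤ 3≤d 3≤d)))
    where
    3≤d : 3 ≤ d
    3≤d = s≤s (s≤s (s≤s z≤n))

  -- Write k = κg and z = ζg with κ and ζ coprime. Then κ divides ζ²g, hence g, so κ² divides k and
  -- κ is 1.
  squarefree∣square⇒∣ : ∀ {k z} → Squarefree k → k ∣ z * z → k ∣ z
  squarefree∣square⇒∣ {k} {z} sf k∣z²
    with g , κ , ζ , refl , refl , κ⊥ζ , g≢0 ← coprimeParts k z (squarefree⇒≢0 sf)
    = divides ζ (cong (ζ *_) (sym (trans (cong (_* g) κ≡1) (*-identityˡ g))))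
    where
    instance _ = ≢-nonZero g≢0

    κ∣ζζg : κ ∣ ζ * ζ * g
    κ∣ζζg = *-cancelʳ-∣ g (subst (κ * g ∣_)
      (solve 2 (λ ζ g → ζ :* g :* (ζ :* g) := ζ :* ζ :* g :* g) refl ζ g) k∣z²)

    κ∣g : κ ∣ g
    κ∣g = coprime-divisor {κ} {ζ * ζ} (coprime-*ʳ {κ} κ⊥ζ κ⊥ζ) κ∣ζζg

    κ≡1 : κ ≡ 1
    κ≡1 = sf κ (*-monoʳ-∣ κ κ∣g)

  -- Once `V` and `w` are made coprime, `V` becomes 1 and kn = w². Then k divides w, say w = ζk, and
  -- n = ζ²k forces ζ = 1.
  squarefreePart-unique : ∀ {k n V w} → Squarefree k → Squarefree n → V ≢ 0 →
    k * n * (V * V) ≡ w * w → k ≡ n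
  squarefreePart-unique {k} {n} {V} {w} sfk sfn V≢0 eq
    with g , V′ , w′ , refl , refl , V′⊥w′ , g≢0 ← coprimeParts V w V≢0
    = conclude (squarefree∣square⇒∣ {k} {w′} sfk (divides n (trans (sym kn≡w′²) (*-comm k n))))
    where
    instance _ = ≢-nonZero g≢0
    instance _ = ≢-nonZero (squarefree⇒≢0 sfk)

    knV′²≡w′² : k * n * (V′ * V′) ≡ w′ * w′
    knV′²≡w′² = *-cancelʳ-≡ _ _ g (*-cancelʳ-≡ _ _ g (trans
      (solve 3 (λ m v g → m :* (v :* v) :* g :* g := m :* (v :* g :* (v :* g))) refl (k * n) V′ g)
      (trans eq (solve 2 (λ w g → w :* g :* (w :* g) := w :* w :* g :* g) refl w′ g))))

    V′≡1 : V′ ≡ 1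
    V′≡1 = coprime-*ʳ {V′} V′⊥w′ V′⊥w′ (∣-refl , divides (k * n * V′)
      (trans (sym knV′²≡w′²) (sym (*-assoc (k * n) V′ V′))))

    kn≡w′² : k * n ≡ w′ * w′
    kn≡w′² = trans (sym (*-identityʳ (k * n)))
      (trans (cong (λ v → k * n * (v * v)) (sym V′≡1)) knV′²≡w′²)

    conclude : k ∣ w′ → k ≡ n
    conclude (divides ζ w′≡ζk) = sym (trans n≡ζζk
        (trans (cong (λ z → z * z * k) ζ≡1) (*-identityˡ k)))
      where
      n≡ζζk : n ≡ ζ * ζ * k
      n≡ζζk = *-cancelˡ-≡ n (ζ * ζ * k) k (trans kn≡w′² (trans (cong (λ w → w * w) w′≡ζk)
        (solve 2 (λ z k → z :* k :* (z :* k) := k :* (z :* z :* k)) refl ζ k)))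

      ζ≡1 : ζ ≡ 1
      ζ≡1 = sfn ζ (divides k (trans n≡ζζk (*-comm (ζ * ζ) k)))

  -- Taking gcds of the two equations gives V²k gcd(A, B) = h² gcd(M, N). Multiplying by gcd(M, N)
  -- turns the right side into a square, and the product of the two gcds is squarefree because it
  -- divides 6.
  squarefree≡gcd*gcd : ∀ {k A B M N V h} → Squarefree k → V ≢ 0 → gcd A B * gcd M N ∣ 6 →
    V * V * (A * k) ≡ h * h * M → V * V * (B * k) ≡ h * h * N → k ≡ gcd A B * gcd M N
  squarefree≡gcd*gcd {k} {A} {B} {M} {N} {V} {h} sf V≢0 ∣6 eqA eqB =
    squarefreePart-unique {k} {g * d} {V} {h * d} sf (squarefree-∣ ∣6 squarefree-6) V≢0 (begin
      k * (g * d) * (V * V)        ≡⟨ solve 4 (λ k g d V → k :* (g :* d) :* (V :* V) := V :* V :* k :* g :* d) refl k g d V ⟩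
      V * V * k * g * d            ≡⟨ cong (_* d) (c*gcd[m,n]≡gcd[cm,cn] (V * V * k) A B) ⟩
      gcd (V * V * k * A) (V * V * k * B) * d ≡⟨ cong₂ (λ a b → gcd a b * d) (trans (swap A) eqA) (trans (swap B) eqB) ⟩
      gcd (h * h * M) (h * h * N) * d ≡⟨ cong (_* d) (c*gcd[m,n]≡gcd[cm,cn] (h * h) M N) ⟨
      h * h * d * d                ≡⟨ solve 2 (λ h d → h :* h :* d :* d := h :* d :* (h :* d)) refl h d ⟩
      h * d * (h * d)              ∎)
    where
    open ≡-Reasoning
    g d : ℕ
    g = gcd A B
    d = gcd M N
    swap : ∀ A → V * V * k * A ≡ V * V * (A * k)
    swap A = solve 3 (λ V k A → V :* V :* k :* A := V :* V :* (A :* k)) refl V k A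

  -- Dividing `y` and `z` by their gcd leaves coprime m and n with gcd(m², n²) = 1, so `k` is gcd(A,
  -- C) itself.
  squares⇒∣2 : ∀ {k A C V y z} → Squarefree k → V ≢ 0 → y ≢ 0 → gcd A C ∣ 2 →
    V * V * (A * k) ≡ y * y → V * V * (C * k) ≡ z * z → k ∣ 2
  squares⇒∣2 {k} {A} {C} {V} {y} {z} sf V≢0 y≢0 ∣2 eqA eqC
    with h , m , n , refl , refl , m⊥n , _ ← coprimeParts y z y≢0
    = subst (_∣ 2) (sym (trans (squarefree≡gcd*gcd {k} {A} {C} {m * m} {n * n} {V} {h} sf V≢0
        (subst (_∣ 6) (sym gcd≡) (∣-trans ∣2 (divides 3 refl)))
        (trans eqA (factor m)) (trans eqC (factor n))) gcd≡)) ∣2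
    where
    factor : ∀ m → m * h * (m * h) ≡ h * h * (m * m)
    factor m = solve 2 (λ m h → m :* h :* (m :* h) := h :* h :* (m :* m)) refl m h

    gcd≡ : gcd A C * gcd (m * m) (n * n) ≡ gcd A C
    gcd≡ = trans (cong (gcd A C *_) (coprime⇒gcd≡1 (coprime-squares {m} {n} m⊥n))) (*-identityʳ _)

  divisor-2 : ∀ {k} → k ∣ 2 → k ≡ 1 ⊎ k ≡ 2
  divisor-2 {0} k∣2 = contradiction k∣2 (from-no (0 ∣? 2))
  divisor-2 {1} _ = inj₁ refl
  divisor-2 {2} _ = inj₂ refl
  divisor-2 {suc (suc (suc _))} k∣2 with s≤s (s≤s ()) ← ∣⇒≤ k∣2

  odd-divisor-2 : ∀ {k} → ¬ 2 ∣ k → k ∣ 2 → k ≡ 1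
  odd-divisor-2 odd k∣2 = [ id , (λ { refl → contradiction ∣-refl odd }) ]′ (divisor-2 k∣2)

  even-divisor-2 : ∀ {k} → 2 ∣ k → k ∣ 2 → k ≡ 2
  even-divisor-2 even k∣2 = ∣-antisym k∣2 even

  odd-divisor-6 : ∀ {k} → ¬ 2 ∣ k → k ∣ 6 → k ≡ 1 ⊎ k ≡ 3
  odd-divisor-6 {0} odd _ = contradiction (2 ∣0) odd
  odd-divisor-6 {1} _ _ = inj₁ refl
  odd-divisor-6 {2} odd _ = contradiction ∣-refl odd
  odd-divisor-6 {3} _ _ = inj₂ refl
  odd-divisor-6 {4} odd _ = contradiction (divides 2 refl) odd
  odd-divisor-6 {5} _ k∣6 = contradiction k∣6 (from-no (5 ∣? 6))
  odd-divisor-6 {6} odd _ = contradiction (divides 3 refl) odd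
  odd-divisor-6 {suc (suc (suc (suc (suc (suc (suc _))))))} _ k∣6
    with s≤s (s≤s (s≤s (s≤s (s≤s (s≤s ()))))) ← ∣⇒≤ k∣6

  even-divisor-6 : ∀ {k} → 2 ∣ k → k ∣ 6 → k ≡ 2 ⊎ k ≡ 6
  even-divisor-6 (divides q refl) k∣6 =
    [ (λ { refl → inj₁ refl }) , (λ { refl → inj₂ refl }) ]′
      (divisor-3 (*-cancelʳ-∣ {q} {3} 2 k∣6))
    where
    divisor-3 : ∀ {q} → q ∣ 3 → q ≡ 1 ⊎ q ≡ 3
    divisor-3 {0} q∣3 = contradiction q∣3 (from-no (0 ∣? 3))
    divisor-3 {1} _ = inj₁ refl
    divisor-3 {2} q∣3 = contradiction q∣3 (from-no (2 ∣? 3))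
    divisor-3 {3} _ = inj₂ refl
    divisor-3 {suc (suc (suc (suc _)))} q∣3 with s≤s (s≤s (s≤s ())) ← ∣⇒≤ q∣3

-- Integer quartic forms and their common divisors.

module _ where
  open import Data.Integer.Base using (ℤ; +_; -[1+_]; -_; _+_; _-_; _*_; ∣_∣; 0ℤ)
  open import Data.Integer.Coprimality using (Coprime; coprime-divisor) renaming (sym to coprime-sym)
  open import Data.Integer.Divisibility using (_∣_)
  open import Data.Integer.Divisibility.Signed as Signed using (∣ᵤ⇒∣; ∣⇒∣ᵤ; ∣m∣n⇒∣m+n; ∣m∣n⇒∣m-n; divides)
  open import Data.Integer.Properties
  open import Data.Integer.Solver using (module +-*-Solver)
  import Data.Nat.Base as ℕ
  import Data.Nat.Coprimality as ℕ
  import Data.Nat.Divisibility as ℕ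
  import Data.Nat.GCD as ℕ
  import Data.Nat.Properties as ℕ
  open +-*-Solver

  -- (q + t)² (p² - q²) and (q + t)² (t² - p²) are - norm q t and norm t q
  -- when pq + qt + tp = 0.
  norm : ℤ → ℤ → ℤ
  norm q t = q * (q * (q * (q + (t + t))))

  -- A common divisor c of `d` and `m` is coprime to `n`, so the factor n³ can be stripped from
  -- `norm n m`. Then c divides n + 2m, hence n as well as m.
  ∣-norm⇒coprime : ∀ d m n → Coprime m n → d ∣ norm n m → Coprime d m
  ∣-norm⇒coprime d m n m⊥n d∣norm {c} (c∣d , c∣m) = m⊥n (c∣m , c∣n)
    where
    c⊥n : Coprime (+ c) n
    c⊥n (x∣c , x∣n) = m⊥n (ℕ.∣-trans x∣c c∣m , x∣n)

    c∣n+2m : + c ∣ n + (m + m)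
    c∣n+2m = coprime-divisor (+ c) n _ c⊥n (coprime-divisor (+ c) n _ c⊥n (coprime-divisor (+ c) n _ c⊥n
      (ℕ.∣-trans c∣d d∣norm)))

    c∣n : + c ∣ n
    c∣n = ∣⇒∣ᵤ (subst (Signed._∣_ (+ c))
      (solve 2 (λ m n → n :+ (m :+ m) :- (m :+ m) := n) refl m n)
      (∣m∣n⇒∣m-n {+ c} {n + (m + m)} {m + m} (∣ᵤ⇒∣ c∣n+2m) (∣m∣n⇒∣m+n {+ c} {m} {m} (∣ᵤ⇒∣ c∣m) (∣ᵤ⇒∣ c∣m))))

  -- The gcd is coprime to both m and n, so it divides m + 2n and n + 2m, and therefore 3m and 3n.
  gcd-norm∣3 : ∀ m n → Coprime m n → ℕ.gcd ∣ norm m n ∣ ∣ norm n m ∣ ℕ.∣ 3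
  gcd-norm∣3 m n m⊥n = ℕ.coprime-factors {∣ m ∣} {∣ n ∣} m⊥n
      (three m n (lin m n d∣norm-mn d∣norm-nm m⊥n) (lin n m d∣norm-nm d∣norm-mn n⊥m) ,
       three n m (lin n m d∣norm-nm d∣norm-mn n⊥m) (lin m n d∣norm-mn d∣norm-nm m⊥n))
    where
    d : ℤ
    d = + ℕ.gcd ∣ norm m n ∣ ∣ norm n m ∣

    n⊥m : Coprime n m
    n⊥m = coprime-sym {m} {n} m⊥n

    d∣norm-mn : d ∣ norm m n
    d∣norm-mn = ℕ.gcd[m,n]∣m ∣ norm m n ∣ ∣ norm n m ∣

    d∣norm-nm : d ∣ norm n m
    d∣norm-nm = ℕ.gcd[m,n]∣n ∣ norm m n ∣ ∣ norm n m ∣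

    lin : ∀ m n → d ∣ norm m n → d ∣ norm n m → Coprime m n → d ∣ m + (n + n)
    lin m n d∣mn d∣nm m⊥n =
      coprime-divisor d m _ d⊥m (coprime-divisor d m _ d⊥m (coprime-divisor d m _ d⊥m d∣mn))
      where
      d⊥m : Coprime d m
      d⊥m = ∣-norm⇒coprime d m n m⊥n d∣nm

    three : ∀ m n → d ∣ m + (n + n) → d ∣ n + (m + m) → ∣ d ∣ ℕ.∣ ∣ m ∣ ℕ.* 3
    three m n d∣m+2n d∣n+2m = subst (∣ d ∣ ℕ.∣_) (abs-* m (+ 3)) (∣⇒∣ᵤ (subst (Signed._∣_ d)
      (solve 2 (λ m n → (n :+ (m :+ m)) :+ (n :+ (m :+ m)) :- (m :+ (n :+ n)) := m :* con (+ 3)) refl m n)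
      (∣m∣n⇒∣m-n {d} {n + (m + m) + (n + (m + m))} {m + (n + n)}
        (∣m∣n⇒∣m+n {d} {n + (m + m)} {n + (m + m)} (∣ᵤ⇒∣ d∣n+2m) (∣ᵤ⇒∣ d∣n+2m)) (∣ᵤ⇒∣ d∣m+2n))))

  coprimePartsℤ : ∀ i j → i ≢ 0ℤ → ∃[ g ] ∃[ m ] ∃[ n ] i ≡ m * + g × j ≡ n * + g × Coprime m n
  coprimePartsℤ i j i≢0
    with g , m′ , n′ , ∣i∣≡ , ∣j∣≡ , m′⊥n′ , g≢0 ← coprimeParts ∣ i ∣ ∣ j ∣ (λ eq → i≢0 (∣i∣≡0⇒i≡0 eq))
    with divides m i≡ ← ∣ᵤ⇒∣ {+ g} {i} (ℕ.divides m′ ∣i∣≡)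
    with divides n j≡ ← ∣ᵤ⇒∣ {+ g} {j} (ℕ.divides n′ ∣j∣≡)
    = g , m , n , i≡ , j≡ , subst₂ ℕ.Coprime (same m i≡ ∣i∣≡) (same n j≡ ∣j∣≡) m′⊥n′
    where
    instance _ = ℕ.≢-nonZero g≢0
    same : ∀ m {i m′} → i ≡ m * + g → ∣ i ∣ ≡ m′ ℕ.* g → m′ ≡ ∣ m ∣
    same m {m′ = m′} i≡ ∣i∣≡ = ℕ.*-cancelʳ-≡ m′ ∣ m ∣ g
      (trans (sym ∣i∣≡) (trans (cong ∣_∣ i≡) (abs-* m (+ g))))

  -- An ideal membership certificate over the integers: both bracketed differences vanish, and the
  -- remaining identity is left to the ring solver.
  combineℤ : ∀ {x y f g f′ g′} c c′ → f ≡ g → f′ ≡ g′ → x ≡ y + c * (f - g) + c′ * (f′ - g′) → x ≡ y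
  combineℤ {y = y} {f} {f′ = f′} c c′ refl refl eq = trans eq
    (solve 5 (λ y f f′ c c′ → y :+ c :* (f :- f) :+ c′ :* (f′ :- f′) := y) refl y f f′ c c′)

  -- The last relation reads P(Q + T) = - QT. Multiplying the other two by (Q + T)² therefore
  -- eliminates `P` and leaves quartic forms in `Q` and `T` alone.
  harmonic⇒∣6 : ∀ {k A B D P Q T} → Squarefree k → ℕ.gcd A B ℕ.∣ 2 →
    D ≢ 0ℤ → Q ≢ 0ℤ → Q + T ≢ 0ℤ →
    D * D * + (A ℕ.* k) + Q * Q ≡ P * P → D * D * + (B ℕ.* k) + P * P ≡ T * T →
    P * Q + Q * T + T * P ≡ 0ℤ → k ℕ.∣ 6
  harmonic⇒∣6 {k} {A} {B} {D} {P} {Q} {T} sf ∣2 D≢0 Q≢0 Q+T≢0 eqA eqB eq0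
    with h , m , n , Q≡ , T≡ , m⊥n ← coprimePartsℤ Q T Q≢0
    = subst (ℕ._∣ 6) (sym (squarefree≡gcd*gcd {k} {A} {B} {∣ norm m n ∣} {∣ norm n m ∣}
        {∣ (Q + T) * D ∣} {h ℕ.* h} sf V≢0 ∣6
        (trans (absV (A ℕ.* k)) (trans (cong ∣_∣ normA) (trans (∣-i∣≡∣i∣ (norm Q T)) (absNorm m n Q≡ T≡))))
        (trans (absV (B ℕ.* k)) (trans (cong ∣_∣ normB) (absNorm n m T≡ Q≡))))) ∣6
    where
    ∣6 : ℕ.gcd A B ℕ.* ℕ.gcd ∣ norm m n ∣ ∣ norm n m ∣ ℕ.∣ 6
    ∣6 = ℕ.*-pres-∣ ∣2 (gcd-norm∣3 m n m⊥n)

    V≢0 : ∣ (Q + T) * D ∣ ≢ 0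
    V≢0 eq = [ Q+T≢0 , D≢0 ]′ (i*j≡0⇒i≡0∨j≡0 (Q + T) (∣i∣≡0⇒i≡0 eq))

    normA : (Q + T) * D * ((Q + T) * D) * + (A ℕ.* k) ≡ - norm Q T
    -- The second multiplier comes from factoring (P(Q + T))² - (QT)².
    normA = combineℤ ((Q + T) * (Q + T)) (P * (Q + T) - Q * T) eqA eq0
      (solve 5 (λ D P Q T a → (Q :+ T) :* D :* ((Q :+ T) :* D) :* a :=
        :- (Q :* (Q :* (Q :* (Q :+ (T :+ T)))))
          :+ ((Q :+ T) :* (Q :+ T)) :* (D :* D :* a :+ Q :* Q :- P :* P)
          :+ (P :* (Q :+ T) :- Q :* T) :* (P :* Q :+ Q :* T :+ T :* P :- con 0ℤ))
        refl D P Q T (+ (A ℕ.* k)))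

    normB : (Q + T) * D * ((Q + T) * D) * + (B ℕ.* k) ≡ norm T Q
    normB = combineℤ ((Q + T) * (Q + T)) (- (P * (Q + T) - Q * T)) eqB eq0
      (solve 5 (λ D P Q T b → (Q :+ T) :* D :* ((Q :+ T) :* D) :* b :=
        (T :* (T :* (T :* (T :+ (Q :+ Q)))))
          :+ ((Q :+ T) :* (Q :+ T)) :* (D :* D :* b :+ P :* P :- T :* T)
          :+ (:- (P :* (Q :+ T) :- Q :* T)) :* (P :* Q :+ Q :* T :+ T :* P :- con 0ℤ))
        refl D P Q T (+ (B ℕ.* k)))

    absV : ∀ a → ∣ (Q + T) * D ∣ ℕ.* ∣ (Q + T) * D ∣ ℕ.* a ≡ ∣ (Q + T) * D * ((Q + T) * D) * + a ∣
    absV a = sym (trans (abs-* ((Q + T) * D * ((Q + T) * D)) (+ a))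
      (cong (ℕ._* a) (abs-* ((Q + T) * D) ((Q + T) * D))))

    -- `norm` is homogeneous of degree 4, so the gcd h of Q and T contributes h⁴, the square of h².
    absNorm : ∀ m n {i j} → i ≡ m * + h → j ≡ n * + h → ∣ norm i j ∣ ≡ h ℕ.* h ℕ.* (h ℕ.* h) ℕ.* ∣ norm m n ∣
    absNorm m n refl refl = trans
      (cong ∣_∣ (solve 3 (λ m n h →
        m :* h :* (m :* h :* (m :* h :* (m :* h :+ (n :* h :+ n :* h)))) :=
        h :* h :* (h :* h) :* (m :* (m :* (m :* (m :+ (n :+ n)))))) refl m n (+ h)))
      (trans (abs-* (+ h * + h * (+ h * + h)) (norm m n))
        (cong (ℕ._* ∣ norm m n ∣) (trans (abs-* (+ h * + h) (+ h * + h))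
          (cong₂ ℕ._*_ (abs-* (+ h) (+ h)) (abs-* (+ h) (+ h))))))

  positive-sum : ∀ r s → ∣ r ∣ ℕ.< s → ∃[ A ] A ≢ 0 × + s + r ≡ + A
  positive-sum (+ n)    s n<s = s ℕ.+ n , (λ eq → ℕ.n≮0 (subst (n ℕ.<_) (ℕ.m+n≡0⇒m≡0 s eq) n<s)) , refl
  positive-sum -[1+ n ] s n<s = s ℕ.∸ suc n , ℕ.m>n⇒m∸n≢0 n<s , ⊖-≥ (ℕ.<⇒≤ n<s)

  -- A common divisor of s - r and s + r divides 2r and 2s, while r and s are coprime.
  ∣s∓r⇒∣2 : ∀ r s {A B} → Coprime r (+ s) → + s - r ≡ + A → + s + r ≡ + B →
    ∀ {d} → d ℕ.∣ A → d ℕ.∣ B → d ℕ.∣ 2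
  ∣s∓r⇒∣2 r s {A} {B} r⊥s s-r≡A s+r≡B {d} d∣A d∣B = ℕ.coprime-factors {∣ r ∣} {s} r⊥s
    ( subst (d ℕ.∣_) (abs-* r (+ 2)) (∣⇒∣ᵤ (subst (Signed._∣_ (+ d))
        (solve 2 (λ r s → (s :+ r) :- (s :- r) := r :* con (+ 2)) refl r (+ s))
        (∣m∣n⇒∣m-n d∣s+r d∣s-r)))
    , subst (d ℕ.∣_) (abs-* (+ s) (+ 2)) (∣⇒∣ᵤ (subst (Signed._∣_ (+ d))
        (solve 2 (λ r s → (s :+ r) :+ (s :- r) := s :* con (+ 2)) refl r (+ s))
        (∣m∣n⇒∣m+n d∣s+r d∣s-r))))
    where
    d∣s-r : + d Signed.∣ + s - r
    d∣s-r = subst (Signed._∣_ (+ d)) (sym s-r≡A) (∣ᵤ⇒∣ d∣A)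

    d∣s+r : + d Signed.∣ + s + r
    d∣s+r = subst (Signed._∣_ (+ d)) (sym s+r≡B) (∣ᵤ⇒∣ d∣B)

open import Data.Integer.Base as ℤ using (ℤ; +_; -[1+_]; +[1+_]; ∣_∣; 0ℤ)
open import Data.Integer.Coprimality using (Coprime)
import Data.Integer.Properties as ℤ
open import Data.Nat.Base as ℕ using (_<_)
import Data.Nat.Coprimality as ℕ
open import Data.Nat.Divisibility as ℕ using (_∣_)
import Data.Nat.GCD as ℕ
open import Data.Nat.Properties as ℕ using (_≤?_)
open import Data.Rational.Base using (ℚ; mkℚ; 0ℚ; 1ℚ; _+_; _*_; _-_; -_; _÷_; _/_; 1/_; ↥_; ↧_; Positive; NonNegative; ≢-nonZero)
open import Data.Rational.Properties hiding (_≤?_)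
open import Data.Rational.Solver using (module +-*-Solver)
open import Data.Rational.Unnormalised.Base using (mkℚᵘ; *≡*)
open +-*-Solver

-- Rational arithmetic and polynomial identities for multiples of a point.

4ℚ : ℚ
4ℚ = 1ℚ + 1ℚ + 1ℚ + 1ℚ

-- For squares x = p², y = q², z = t² this says ± 1/p ± 1/q ± 1/t = 0.
Flex : ℚ → ℚ → ℚ → Set
Flex x y z = (x * y + x * z - y * z) * (x * y + x * z - y * z) ≡ 4ℚ * x * x * y * z

flexL flexR : ∀ {n} (x y z : Polynomial n) → Polynomial n
flexL x y z = (x :* y :+ x :* z :- y :* z) :* (x :* y :+ x :* z :- y :* z)
flexR x y z = con 4ℚ :* x :* x :* y :* z

-- For nonzero roots the last equation is 1/p + 1/q + 1/t = 0 with denominators cleared. The signs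
-- are absorbed into the choice of square roots.
HarmonicRoots : ℚ → ℚ → ℚ → Set
HarmonicRoots x y z = ∃[ p ] ∃[ q ] ∃[ t ]
  x ≡ p * p × y ≡ q * q × z ≡ t * t × p * q + q * t + t * p ≡ 0ℚ

quotient : ∀ n d → d ≢ 0ℚ → ∃[ p ] p * d ≡ n
quotient n d d≢0 = n ÷ d , trans (*-assoc n (1/ d) d)
    (trans (cong (n *_) (*-inverseˡ d)) (*-identityʳ n))
  where instance _ = ≢-nonZero d≢0

opaque
  -- The shape of an ideal membership certificate: x - y is a combination of
  -- differences of known equalities.
  combine₁ : ∀ {x y f g} c → f ≡ g → x ≡ y + c * (f - g) → x ≡ y
  combine₁ {y = y} {f} c refl eq =
    trans eq (solve 3 (λ y c f → y :+ c :* (f :- f) := y) refl y c f)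

  combine₂ : ∀ {x y f g f′ g′} c c′ → f ≡ g → f′ ≡ g′ →
    x ≡ y + c * (f - g) + c′ * (f′ - g′) → x ≡ y
  combine₂ c c′ eq eq′ e = combine₁ c eq (combine₁ c′ eq′ e)

  combine₃ : ∀ {x y f g f′ g′ f″ g″} c c′ c″ → f ≡ g → f′ ≡ g′ → f″ ≡ g″ →
    x ≡ y + c * (f - g) + c′ * (f′ - g′) + c″ * (f″ - g″) → x ≡ y
  combine₃ c c′ c″ eq eq′ eq″ e = combine₂ c c′ eq eq′ (combine₁ c″ eq″ e)

  p-q≡0⇒p≡q : ∀ p q → p - q ≡ 0ℚ → p ≡ q
  p-q≡0⇒p≡q p q eq = combine₁ 1ℚ eq
    (solve 2 (λ p q → p := q :+ con 1ℚ :* ((p :- q) :- con 0ℚ)) refl p q)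

  p+q≡0⇒p≡-q : ∀ p q → p + q ≡ 0ℚ → p ≡ - q
  p+q≡0⇒p≡-q p q eq = combine₁ 1ℚ eq
    (solve 2 (λ p q → p := :- q :+ con 1ℚ :* ((p :+ q) :- con 0ℚ)) refl p q)

  neg-involutive : ∀ p → - (- p) ≡ p
  neg-involutive = solve 1 (λ p → :- (:- p) := p) refl

  p≢q⇒q-p≢0 : ∀ {p q} → p ≢ q → q - p ≢ 0ℚ
  p≢q⇒q-p≢0 {p} {q} p≢q eq = p≢q (sym (p-q≡0⇒p≡q q p eq))

  *-cancelˡ-≢0 : ∀ d {p q} → d ≢ 0ℚ → d * p ≡ d * q → p ≡ q
  *-cancelˡ-≢0 d {p} {q} d≢0 eq with quotient 1ℚ d d≢0
  ... | i , id≡1 = combine₂ i (q - p) eq id≡1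
    (solve 4 (λ i d p q → p := q :+ i :* (d :* p :- d :* q) :+ (q :- p) :* (i :* d :- con 1ℚ))
      refl i d p q)

  p*q≡0⇒p≡0⊎q≡0 : ∀ p {q} → p * q ≡ 0ℚ → p ≡ 0ℚ ⊎ q ≡ 0ℚ
  p*q≡0⇒p≡0⊎q≡0 p eq with p ≟ 0ℚ
  ... | yes p≡0 = inj₁ p≡0
  ... | no  p≢0 = inj₂ (*-cancelˡ-≢0 p p≢0 (trans eq (sym (*-zeroʳ p))))

  p≢0∧q≢0⇒p*q≢0 : ∀ {p q} → p ≢ 0ℚ → q ≢ 0ℚ → p * q ≢ 0ℚ
  p≢0∧q≢0⇒p*q≢0 {p} p≢0 q≢0 eq = [ p≢0 , q≢0 ]′ (p*q≡0⇒p≡0⊎q≡0 p eq)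

  p*p≡q*q⇒p≡q⊎p≡-q : ∀ p q → p * p ≡ q * q → p ≡ q ⊎ p ≡ - q
  p*p≡q*q⇒p≡q⊎p≡-q p q eq = Sum.map (p-q≡0⇒p≡q p q)
    (p+q≡0⇒p≡-q p q)
    (p*q≡0⇒p≡0⊎q≡0 (p - q) (combine₁ 1ℚ eq
      (solve 2 (λ p q → (p :- q) :* (p :+ q) := con 0ℚ :+ con 1ℚ :* (p :* p :- q :* q)) refl p q)))

  p≡-p⇒p≡0 : ∀ p → p ≡ - p → p ≡ 0ℚ
  p≡-p⇒p≡0 p eq = *-cancelˡ-≢0 (1ℚ + 1ℚ) (λ ()) (combine₁ 1ℚ eq
    (solve 1 (λ p → (con 1ℚ :+ con 1ℚ) :* p
       := (con 1ℚ :+ con 1ℚ) :* con 0ℚ :+ con 1ℚ :* (p :- :- p)) refl p))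

  p*p≡0⇒p≡0 : ∀ p → p * p ≡ 0ℚ → p ≡ 0ℚ
  p*p≡0⇒p≡0 p eq = [ (λ z → z) , (λ z → z) ]′ (p*q≡0⇒p≡0⊎q≡0 p eq)

  -- Points are written (u , y) in coordinates centred at a root e of the cubic,
  -- so that the curve is y² = u (u + a) (u + b).

  -- Translation by T = (0 , 0) turns the abscissa u of P into ab/u for T - P; here `l` is the slope
  -- of the chord from T to - P.
  translate-x : ∀ u v a b l y → u ≢ 0ℚ → l * u ≡ - y → v ≡ l * l - (a + b) - u →
    y * y ≡ u * (u + a) * (u + b) → v * u ≡ a * b
  translate-x u v a b l y u≢0 l≡ v≡ y²≡ = *-cancelˡ-≢0 u u≢0
    (combine₃ (l * u - y) (u * u) 1ℚ l≡ v≡ y²≡ (solve 6 (λ u v a b l y →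
      u :* (v :* u) := u :* (a :* b) :+ (l :* u :- y) :* (l :* u :- :- y)
        :+ (u :* u) :* (v :- (l :* l :- (a :+ b) :- u))
        :+ con 1ℚ :* (y :* y :- u :* (u :+ a) :* (u :+ b))) refl u v a b l y))

  -- The duplication formula: `l` is the tangent slope at (u , y) and `v` the abscissa of the
  -- double.
  doubling-identity : ∀ u v a b l y →
    l * (y + y) ≡ u * u + u * u + u * u + (a + b) * (u + u) + a * b →
    v ≡ l * l - (a + b) - u - u → y * y ≡ u * (u + a) * (u + b) →
    v * ((y + y) * (y + y)) ≡ (u * u - a * b) * (u * u - a * b)
  doubling-identity u v a b l y l≡ v≡ y²≡ =
    combine₃ (l * (y + y) + (u * u + u * u + u * u + (a + b) * (u + u) + a * b))
      ((y + y) * (y + y)) (- (4ℚ * (a + b + u + u))) l≡ v≡ y²≡ (solve 6 (λ u v a b l y →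
        let t = u :* u :+ u :* u :+ u :* u :+ (a :+ b) :* (u :+ u) :+ a :* b in
        v :* ((y :+ y) :* (y :+ y)) := (u :* u :- a :* b) :* (u :* u :- a :* b)
          :+ (l :* (y :+ y) :+ t) :* (l :* (y :+ y) :- t)
          :+ ((y :+ y) :* (y :+ y)) :* (v :- (l :* l :- (a :+ b) :- u :- u))
          :+ (:- (con 4ℚ :* (a :+ b :+ u :+ u))) :* (y :* y :- u :* (u :+ a) :* (u :+ b)))
        refl u v a b l y)

  -- Here (v , _) is 2P, (w , y₃) is T - P and m is the slope of the line
  -- through -P and T - P.
  octuple-identity : ∀ u v w a b m y y₃ → u ≢ 0ℚ → u ≢ w →
    w * u ≡ a * b → y₃ * u ≡ y * w → m * (w - u) ≡ y₃ + y → v ≡ m * m - (a + b) - u - w →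
    y * y ≡ u * (u + a) * (u + b) →
    v * ((y + y) * (y + y)) ≡ (u * u - a * b) * (u * u - a * b) → v * v ≡ a * b
  octuple-identity u v w a b m y y₃ u≢0 u≢w wu≡ y₃≡ m≡ v≡ y²≡ dbl =
    -- Since uw = ab, the number u² - ab is u(u - w). Hence `vd≡` times v, combined with the
    -- duplication formula, gives d²v² = d²ab for d = (w - u)u.
    *-cancelˡ-≢0 (((w - u) * u) * ((w - u) * u)) (p≢0∧q≢0⇒p*q≢0 d≢0 d≢0)
      (combine₃ v (u * w) ((u * u - a * b) * (u * u - a * b) + a * b * (u * u + u * u - a * b - u * w))
        vd≡ dbl wu≡ (solve 6 (λ u v w a b y →
        let d = (w :- u) :* u in
        d :* d :* (v :* v) := d :* d :* (a :* b)
          :+ v :* (v :* (d :* d) :- (y :+ y) :* (y :+ y) :* (u :* w))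
          :+ (u :* w) :* (v :* ((y :+ y) :* (y :+ y)) :- (u :* u :- a :* b) :* (u :* u :- a :* b))
          :+ ((u :* u :- a :* b) :* (u :* u :- a :* b) :+ a :* b :* (u :* u :+ u :* u :- a :* b :- u :* w))
             :* (w :* u :- a :* b)) refl u v w a b y))
    where
    d≢0 : (w - u) * u ≢ 0ℚ
    d≢0 = p≢0∧q≢0⇒p*q≢0 (p≢q⇒q-p≢0 u≢w) u≢0

    md≡ : m * (w - u) * u ≡ y * (w + u)
    md≡ = combine₂ u 1ℚ m≡ y₃≡ (solve 5 (λ u w m y y₃ →
      m :* (w :- u) :* u := y :* (w :+ u) :+ u :* (m :* (w :- u) :- (y₃ :+ y))
        :+ con 1ℚ :* (y₃ :* u :- y :* w)) refl u w m y y₃)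

    y²≡u²[a+b+u+w] : y * y ≡ u * u * (a + b + u + w)
    y²≡u²[a+b+u+w] = combine₂ 1ℚ (- u) y²≡ wu≡ (solve 5 (λ u w a b y →
      y :* y := u :* u :* (a :+ b :+ u :+ w) :+ con 1ℚ :* (y :* y :- u :* (u :+ a) :* (u :+ b))
        :+ (:- u) :* (w :* u :- a :* b)) refl u w a b y)

    -- Inserting the slope `m` leaves y²((w + u)² - (w - u)²), which is 4y²uw.
    vd≡ : v * (((w - u) * u) * ((w - u) * u)) ≡ (y + y) * (y + y) * (u * w)
    vd≡ = combine₃ (((w - u) * u) * ((w - u) * u)) (m * (w - u) * u + y * (w + u)) ((w - u) * (w - u))
      v≡ md≡ y²≡u²[a+b+u+w] (solve 7 (λ u v w a b m y →
        let d = (w :- u) :* u in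
        v :* (d :* d) := (y :+ y) :* (y :+ y) :* (u :* w)
          :+ (d :* d) :* (v :- (m :* m :- (a :+ b) :- u :- w))
          :+ (m :* (w :- u) :* u :+ y :* (w :+ u)) :* (m :* (w :- u) :* u :- y :* (w :+ u))
          :+ ((w :- u) :* (w :- u)) :* (y :* y :- u :* u :* (a :+ b :+ u :+ w))) refl u v w a b m y)

  -- The witness is w = y/u: dividing (u + a)(u + b) by u leaves 2u + a + b because ab/u = u.
  halving-identity : ∀ u a b y → u ≢ 0ℚ → u * u ≡ a * b → y * y ≡ u * (u + a) * (u + b) →
    ∃[ w ] w * w ≡ u + u + a + b
  halving-identity u a b y u≢0 u²≡ y²≡ with quotient y u u≢0
  ... | w , wu≡ = w , *-cancelˡ-≢0 (u * u) (p≢0∧q≢0⇒p*q≢0 u≢0 u≢0)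
    (combine₃ (w * u + y) 1ℚ (- u) wu≡ y²≡ u²≡ (solve 5 (λ u a b y w →
      u :* u :* (w :* w) := u :* u :* (u :+ u :+ a :+ b) :+ (w :* u :+ y) :* (w :* u :- y)
        :+ con 1ℚ :* (y :* y :- u :* (u :+ a) :* (u :+ b))
        :+ (:- u) :* (u :* u :- a :* b)) refl u a b y w))

  -- If 3P = O, then 2P and P share the abscissa u, so the duplication formula becomes a condition
  -- on u alone.
  triple⇒flex : ∀ u a b y → y * y ≡ u * (u + a) * (u + b) →
    u * ((y + y) * (y + y)) ≡ (u * u - a * b) * (u * u - a * b) → Flex u (u + a) (u + b)
  triple⇒flex u a b y y²≡ dbl = combine₂ (4ℚ * u) (- 1ℚ) y²≡ dbl (solve 4 (λ x a b y →
    let n = x :* (x :+ a) :+ x :* (x :+ b) :- (x :+ a) :* (x :+ b) in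
    n :* n := con 4ℚ :* x :* x :* (x :+ a) :* (x :+ b)
      :+ (con 4ℚ :* x) :* (y :* y :- x :* (x :+ a) :* (x :+ b))
      :+ (:- con 1ℚ) :* (x :* ((y :+ y) :* (y :+ y)) :- (x :* x :- a :* b) :* (x :* x :- a :* b)))
    refl u a b y)

  -- If 3P is T = (0 , 0), then 2P = T - P has abscissa v with uv = ab. Eliminating u from the
  -- duplication formula first gives (u - v)² = 4(v + a)(v + b); multiplying by v² removes the
  -- remaining u.
  sextuple⇒flex : ∀ u v a b y → u ≢ 0ℚ → v * u ≡ a * b → y * y ≡ u * (u + a) * (u + b) →
    v * ((y + y) * (y + y)) ≡ (u * u - a * b) * (u * u - a * b) → Flex v (v + a) (v + b)
  sextuple⇒flex u v a b y u≢0 vu≡ y²≡ dbl =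
    combine₂ (v * v) (v * v + v * v - a * b - u * v) [u-v]²≡ vu≡ (solve 4 (λ u v a b →
      let n = v :* (v :+ a) :+ v :* (v :+ b) :- (v :+ a) :* (v :+ b) in
      n :* n := con 4ℚ :* v :* v :* (v :+ a) :* (v :+ b)
        :+ (v :* v) :* ((u :- v) :* (u :- v) :- con 4ℚ :* ((v :+ a) :* (v :+ b)))
        :+ (v :* v :+ v :* v :- a :* b :- u :* v) :* (v :* u :- a :* b)) refl u v a b)
    where
    [u-v]²≡ : (u - v) * (u - v) ≡ 4ℚ * ((v + a) * (v + b))
    [u-v]²≡ = *-cancelˡ-≢0 (u * u) (p≢0∧q≢0⇒p*q≢0 u≢0 u≢0)
      (combine₃ (4ℚ * u * (u - v) - (u * u + u * u - u * v - a * b)) (- 1ℚ) (4ℚ * v) vu≡ dbl y²≡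
        (solve 5 (λ u v a b y →
          u :* u :* ((u :- v) :* (u :- v)) := u :* u :* (con 4ℚ :* ((v :+ a) :* (v :+ b)))
            :+ (con 4ℚ :* u :* (u :- v) :- (u :* u :+ u :* u :- u :* v :- a :* b)) :* (v :* u :- a :* b)
            :+ (:- con 1ℚ) :* (v :* ((y :+ y) :* (y :+ y)) :- (u :* u :- a :* b) :* (u :* u :- a :* b))
            :+ (con 4ℚ :* v) :* (y :* y :- u :* (u :+ a) :* (u :+ b))) refl u v a b y))

  -- As in Heron's formula, the condition factors into the four sign variants of pq + qt + tp. Each
  -- vanishing factor is repaired by negating at most one root.
  flex⇒harmonicRoots : ∀ p q t {x y z} → x ≡ p * p → y ≡ q * q → z ≡ t * t →
    Flex x y z → HarmonicRoots x y z
  flex⇒harmonicRoots p q t refl refl refl flex =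
    [ (λ h → [ case₁ , case₂ ]′ (p*q≡0⇒p≡0⊎q≡0 (p * q + q * t + t * p) h))
    , (λ h → [ case₃ , case₄ ]′ (p*q≡0⇒p≡0⊎q≡0 (p * q - q * t + t * p) h))
    ]′ (p*q≡0⇒p≡0⊎q≡0 ((p * q + q * t + t * p) * (p * q + q * t - t * p)) product≡0)
    where
    neg-square : ∀ p → (- p) * (- p) ≡ p * p
    neg-square = solve 1 (λ p → (:- p) :* (:- p) := p :* p) refl

    case₁ : p * q + q * t + t * p ≡ 0ℚ → HarmonicRoots (p * p) (q * q) (t * t)
    case₁ h = p , q , t , refl , refl , refl , h

    case₂ : p * q + q * t - t * p ≡ 0ℚ → HarmonicRoots (p * p) (q * q) (t * t)
    case₂ h = p , - q , t , refl , sym (neg-square q) , refl , trans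
      (solve 3 (λ p q t → p :* (:- q) :+ (:- q) :* t :+ t :* p := :- (p :* q :+ q :* t :- t :* p))
        refl p q t) (cong -_ h)

    case₃ : p * q - q * t + t * p ≡ 0ℚ → HarmonicRoots (p * p) (q * q) (t * t)
    case₃ h = - p , q , t , sym (neg-square p) , refl , refl , trans
      (solve 3 (λ p q t → (:- p) :* q :+ q :* t :+ t :* (:- p) := :- (p :* q :- q :* t :+ t :* p))
        refl p q t) (cong -_ h)

    case₄ : - (p * q) + q * t + t * p ≡ 0ℚ → HarmonicRoots (p * p) (q * q) (t * t)
    case₄ h = p , q , - t , refl , refl , sym (neg-square t) , trans
      (solve 3 (λ p q t → p :* q :+ q :* (:- t) :+ (:- t) :* p := :- (:- (p :* q) :+ q :* t :+ t :* p))
        refl p q t) (cong -_ h)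

    product≡0 : ((p * q + q * t + t * p) * (p * q + q * t - t * p))
      * ((p * q - q * t + t * p) * (- (p * q) + q * t + t * p)) ≡ 0ℚ
    product≡0 = combine₁ (- 1ℚ) flex (solve 3 (λ p q t →
      let x = p :* p
          y = q :* q
          z = t :* t
          n = x :* y :+ x :* z :- y :* z
      in ((p :* q :+ q :* t :+ t :* p) :* (p :* q :+ q :* t :- t :* p))
           :* ((p :* q :- q :* t :+ t :* p) :* (:- (p :* q) :+ q :* t :+ t :* p)) :=
         con 0ℚ :+ (:- con 1ℚ) :* (n :* n :- con 4ℚ :* x :* x :* y :* z)) refl p q t)

-- Chord-and-tangent addition described by slopes.

module CurveProperties (α β : ℚ) where
  open Curve α β

  aff-cong : ∀ {x y x′ y′} .{e : OnCurve x y} .{e′ : OnCurve x′ y′} →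
    x ≡ x′ → y ≡ y′ → aff x y e ≡ aff x′ y′ e′
  aff-cong refl refl = refl

  aff-injective : ∀ {x y x′ y′} .{e : OnCurve x y} .{e′ : OnCurve x′ y′} →
    aff x y e ≡ aff x′ y′ e′ → x ≡ x′ × y ≡ y′
  aff-injective refl = refl , refl

  -- Decidable equality of rationals recovers a relevant proof from the irrelevant one stored in
  -- `aff`.
  onCurve : ∀ x y → .(OnCurve x y) → OnCurve x y
  onCurve x y e = recompute (y * y ≟ cubic x) e

  opaque
    neg-onCurve : ∀ x y → OnCurve x y → OnCurve x (- y)
    neg-onCurve x y e = trans (solve 1 (λ y → (:- y) :* (:- y) := y :* y) refl y) e

  ⊖_ : Point → Point
  ⊖ O         = O
  ⊖ aff x y e = aff x (- y) (neg-onCurve x y e)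

  -- (cubic x₂ - cubic x₁) / (x₂ - x₁)
  divided : ℚ → ℚ → ℚ
  divided x₁ x₂ = x₁ * x₁ + x₁ * x₂ + x₂ * x₂ + (β - α) * (x₁ + x₂) - α * β

  -- The second equation is the first multiplied by (y₁ + y₂) / (x₂ - x₁); the
  -- two together treat chords and tangents uniformly.
  record IsSlope (l x₁ y₁ x₂ y₂ : ℚ) : Set where
    constructor isSlope
    field
      chord   : l * (x₂ - x₁) ≡ y₂ - y₁
      tangent : l * (y₁ + y₂) ≡ divided x₁ x₂

  Opposite : (x₁ y₁ x₂ y₂ : ℚ) → Set
  Opposite x₁ y₁ x₂ y₂ = x₁ ≡ x₂ × y₁ ≡ - y₂

  -- Unless the points are opposite, x₂ - x₁ or y₁ + y₂ is nonzero, and the matching equation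
  -- determines the slope.
  slope-unique : ∀ {l l′ x₁ y₁ x₂ y₂} → ¬ Opposite x₁ y₁ x₂ y₂ →
    IsSlope l x₁ y₁ x₂ y₂ → IsSlope l′ x₁ y₁ x₂ y₂ → l ≡ l′
  slope-unique {l} {l′} {x₁} {y₁} {x₂} {y₂} ¬opp (isSlope c t) (isSlope c′ t′) with x₁ ≟ x₂
  ... | no x₁≢x₂ = *-cancelˡ-≢0 (x₂ - x₁) (p≢q⇒q-p≢0 x₁≢x₂)
    (trans (*-comm (x₂ - x₁) l) (trans (trans c (sym c′)) (*-comm l′ (x₂ - x₁))))
  ... | yes x₁≡x₂ = *-cancelˡ-≢0 (y₁ + y₂)
    (λ eq → ¬opp (x₁≡x₂ , p+q≡0⇒p≡-q y₁ y₂ eq))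
    (trans (*-comm (y₁ + y₂) l) (trans (trans t (sym t′)) (*-comm l′ (y₁ + y₂))))

  chord-isSlope : ∀ {l x₁ y₁ x₂ y₂} → OnCurve x₁ y₁ → OnCurve x₂ y₂ → x₁ ≢ x₂ →
    l * (x₂ - x₁) ≡ y₂ - y₁ → IsSlope l x₁ y₁ x₂ y₂
  chord-isSlope {l} {x₁} {y₁} {x₂} {y₂} e₁ e₂ x₁≢x₂ c = isSlope c
    (*-cancelˡ-≢0 (x₂ - x₁) (p≢q⇒q-p≢0 x₁≢x₂)
      (combine₃ (y₁ + y₂) 1ℚ (- 1ℚ) c e₂ e₁
        (solve 7 (λ α β l x₁ y₁ x₂ y₂ →
          let cubic x = x :* (x :- α) :* (x :+ β)
              div = x₁ :* x₁ :+ x₁ :* x₂ :+ x₂ :* x₂ :+ (β :- α) :* (x₁ :+ x₂) :- α :* β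
          in (x₂ :- x₁) :* (l :* (y₁ :+ y₂)) :=
             (x₂ :- x₁) :* div :+ (y₁ :+ y₂) :* (l :* (x₂ :- x₁) :- (y₂ :- y₁))
               :+ con 1ℚ :* (y₂ :* y₂ :- cubic x₂) :+ (:- con 1ℚ) :* (y₁ :* y₁ :- cubic x₁))
          refl α β l x₁ y₁ x₂ y₂)))

  tangent-isSlope : ∀ {l x y₁ y₂} → OnCurve x y₁ → OnCurve x y₂ → y₁ ≢ - y₂ →
    l * (y₁ + y₂) ≡ cubic′ x → IsSlope l x y₁ x y₂
  tangent-isSlope {l} {x} {y₁} {y₂} e₁ e₂ y₁≢-y₂ t = isSlope
    (combine₁ (- 1ℚ) y₂≡y₁
      (solve 4 (λ l x y₁ y₂ → l :* (x :- x) :=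
         (y₂ :- y₁) :+ (:- con 1ℚ) :* (y₂ :- y₁)) refl l x y₁ y₂))
    (trans t (solve 3 (λ α β x →
      (x :- α) :* (x :+ β) :+ x :* (x :+ β) :+ x :* (x :- α) :=
      x :* x :+ x :* x :+ x :* x :+ (β :- α) :* (x :+ x) :- α :* β) refl α β x))
    where
    y₂≡y₁ : y₂ ≡ y₁
    y₂≡y₁ with p*p≡q*q⇒p≡q⊎p≡-q y₁ y₂ (trans e₁ (sym e₂))
    ... | inj₁ eq = sym eq
    ... | inj₂ eq = contradiction eq y₁≢-y₂

  ⊕-opposite : ∀ {x₁ y₁ x₂ y₂} .{e₁ : OnCurve x₁ y₁} .{e₂ : OnCurve x₂ y₂} →
    Opposite x₁ y₁ x₂ y₂ → aff x₁ y₁ e₁ ⊕ aff x₂ y₂ e₂ ≡ O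
  ⊕-opposite {x₁} {y₁} {x₂} {y₂} (x₁≡x₂ , y₁≡-y₂) with x₁ ≟ x₂ | y₁ ≟ - y₂
  ... | no x₁≢x₂ | _         = contradiction x₁≡x₂ x₁≢x₂
  ... | yes _    | no y₁≢-y₂ = contradiction y₁≡-y₂ y₁≢-y₂
  ... | yes _    | yes _     = refl

  -- A view of the sum in which chords and tangents form a single case.
  data IsSum (x₁ y₁ x₂ y₂ : ℚ) : Point → Set where
    opposite : Opposite x₁ y₁ x₂ y₂ → IsSum x₁ y₁ x₂ y₂ O
    secant   : ∀ l → ¬ Opposite x₁ y₁ x₂ y₂ → IsSlope l x₁ y₁ x₂ y₂ →
      .{e : OnCurve (sumX l x₁ x₂) (sumY l x₁ y₁ x₂)} →
      IsSum x₁ y₁ x₂ y₂ (aff (sumX l x₁ x₂) (sumY l x₁ y₁ x₂) e)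

  opaque
    ⊕-sum : ∀ x₁ y₁ x₂ y₂ .{e₁ : OnCurve x₁ y₁} .{e₂ : OnCurve x₂ y₂} →
      IsSum x₁ y₁ x₂ y₂ (aff x₁ y₁ e₁ ⊕ aff x₂ y₂ e₂)
    ⊕-sum x₁ y₁ x₂ y₂ {e₁} {e₂} with x₁ ≟ x₂ | y₁ ≟ - y₂
    ... | no x₁≢x₂ | _ = secant (chordSlope x₁ y₁ x₂ y₂ x₁≢x₂) (λ opp → x₁≢x₂ (proj₁ opp))
      (chord-isSlope (onCurve x₁ y₁ e₁) (onCurve x₂ y₂ e₂) x₁≢x₂
        (proj₂ (quotient (y₂ - y₁) (x₂ - x₁) (p≢q⇒q-p≢0 x₁≢x₂))))
    ... | yes x₁≡x₂ | yes y₁≡-y₂ = opposite (x₁≡x₂ , y₁≡-y₂)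
    ... | yes refl  | no y₁≢-y₂ = secant (tangentSlope x₁ y₁ y₂ y₁≢-y₂) (λ opp → y₁≢-y₂ (proj₂ opp))
      (tangent-isSlope (onCurve x₁ y₁ e₁) (onCurve x₁ y₂ e₂) y₁≢-y₂
        (proj₂ (quotient (cubic′ x₁) (y₁ + y₂) (λ eq → y₁≢-y₂ (p+q≡0⇒p≡-q y₁ y₂ eq)))))

  opaque
    ⊕-secant : ∀ {l x₁ y₁ x₂ y₂ x₃ y₃} .{e₁ : OnCurve x₁ y₁} .{e₂ : OnCurve x₂ y₂} .{e₃ : OnCurve x₃ y₃} →
      ¬ Opposite x₁ y₁ x₂ y₂ → IsSlope l x₁ y₁ x₂ y₂ →
      x₃ ≡ sumX l x₁ x₂ → y₃ ≡ sumY l x₁ y₁ x₂ → aff x₁ y₁ e₁ ⊕ aff x₂ y₂ e₂ ≡ aff x₃ y₃ e₃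
    ⊕-secant {l} {x₁} {y₁} {x₂} {y₂} {e₁ = e₁} {e₂} ¬opp sl refl refl
      with aff x₁ y₁ e₁ ⊕ aff x₂ y₂ e₂ | ⊕-sum x₁ y₁ x₂ y₂ {e₁} {e₂}
    ... | _ | opposite opp    = contradiction opp ¬opp
    ... | _ | secant l′ _ sl′ with refl ← slope-unique ¬opp sl′ sl = refl

  opaque
    ⊖-inverseˡ : ∀ P → ⊖ P ⊕ P ≡ O
    ⊖-inverseˡ O           = refl
    ⊖-inverseˡ (aff x y e) = ⊕-opposite {x} {_} {x} (refl , refl)

  opaque
    -- Reflection in the x-axis carries a secant of slope l to one of slope - l.
    ⊖-distrib-⊕ : ∀ P Q → ⊖ (P ⊕ Q) ≡ ⊖ P ⊕ ⊖ Q
    ⊖-distrib-⊕ O              Q              = refl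
    ⊖-distrib-⊕ (aff x₁ y₁ e₁) O              = refl
    ⊖-distrib-⊕ (aff x₁ y₁ e₁) (aff x₂ y₂ e₂)
      with aff x₁ y₁ e₁ ⊕ aff x₂ y₂ e₂ | ⊕-sum x₁ y₁ x₂ y₂ {e₁} {e₂}
    ... | _ | opposite (x₁≡x₂ , y₁≡-y₂) = sym (⊕-opposite {x₁} {_} {x₂} (x₁≡x₂ , cong -_ y₁≡-y₂))
    ... | _ | secant l ¬opp (isSlope c t) = sym (⊕-secant { - l}
      (λ (x₁≡x₂ , eq) → ¬opp (x₁≡x₂ , neg-injective eq))
      (isSlope
        (combine₁ (- 1ℚ) c (solve 5 (λ l x₁ y₁ x₂ y₂ →
          (:- l) :* (x₂ :- x₁) := (:- y₂ :- :- y₁) :+ (:- con 1ℚ) :* (l :* (x₂ :- x₁) :- (y₂ :- y₁)))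
          refl l x₁ y₁ x₂ y₂))
        (trans (solve 3 (λ l y₁ y₂ → (:- l) :* (:- y₁ :+ :- y₂) := l :* (y₁ :+ y₂)) refl l y₁ y₂) t))
      (solve 5 (λ α β l x₁ x₂ → l :* l :- (β :- α) :- x₁ :- x₂
        := (:- l) :* (:- l) :- (β :- α) :- x₁ :- x₂) refl α β l x₁ x₂)
      (solve 6 (λ α β l x₁ y₁ x₂ →
        :- (l :* (x₁ :- (l :* l :- (β :- α) :- x₁ :- x₂)) :- y₁)
        := (:- l) :* (x₁ :- ((:- l) :* (:- l) :- (β :- α) :- x₁ :- x₂)) :- :- y₁) refl α β l x₁ y₁ x₂))

    -- The line through P, Q and ⊖ (P ⊕ Q) reflects to one through ⊖ P, P ⊕ Q
    -- and ⊖ Q.  If y₁ vanishes, nonsingularity of the curve would be needed.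
    ⊖-cancelˡ : ∀ {x₁ y₁} .{e₁ : OnCurve x₁ y₁} → y₁ ≢ 0ℚ → ∀ Q →
      ⊖ aff x₁ y₁ e₁ ⊕ (aff x₁ y₁ e₁ ⊕ Q) ≡ Q
    ⊖-cancelˡ {x₁} {y₁} {e₁} y₁≢0 O = ⊖-inverseˡ (aff x₁ y₁ e₁)
    ⊖-cancelˡ {x₁} {y₁} {e₁} y₁≢0 (aff x₂ y₂ e₂)
      with aff x₁ y₁ e₁ ⊕ aff x₂ y₂ e₂ | ⊕-sum x₁ y₁ x₂ y₂ {e₁} {e₂}
    ... | _ | opposite (x₁≡x₂ , y₁≡-y₂) = aff-cong x₁≡x₂ (trans (cong -_ y₁≡-y₂) (neg-involutive y₂))
    ... | _ | secant l _ (isSlope c t) = ⊕-secant { - l}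
      -- If ⊖ P and P ⊕ Q were opposite, then x₃ = x₁ and y₃ = y₁, whereas the line gives y₃ = - y₁
      -- at x₃ = x₁.
      (λ (x₁≡x₃ , eq) → y₁≢0 (p≡-p⇒p≡0 y₁ (combine₂ (- 1ℚ) l eq x₁≡x₃
        (solve 4 (λ l x₁ y₁ x₃ → let y₃ = l :* (x₁ :- x₃) :- y₁ in
          y₁ := :- y₁ :+ (:- con 1ℚ) :* (:- y₁ :- :- y₃) :+ l :* (x₁ :- x₃))
          refl l x₁ y₁ (sumX l x₁ x₂)))))
      (isSlope
        (solve 4 (λ l x₁ y₁ x₃ → let y₃ = l :* (x₁ :- x₃) :- y₁ in
          (:- l) :* (x₃ :- x₁) := y₃ :- :- y₁) refl l x₁ y₁ (sumX l x₁ x₂))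
        (combine₂ l 1ℚ c t (solve 7 (λ α β l x₁ y₁ x₂ y₂ →
          let x₃ = l :* l :- (β :- α) :- x₁ :- x₂
              y₃ = l :* (x₁ :- x₃) :- y₁
              div x₁ x₂ = x₁ :* x₁ :+ x₁ :* x₂ :+ x₂ :* x₂ :+ (β :- α) :* (x₁ :+ x₂) :- α :* β
          in (:- l) :* (:- y₁ :+ y₃) := div x₁ x₃
               :+ l :* (l :* (x₂ :- x₁) :- (y₂ :- y₁))
               :+ con 1ℚ :* (l :* (y₁ :+ y₂) :- div x₁ x₂)) refl α β l x₁ y₁ x₂ y₂)))
      (solve 5 (λ α β l x₁ x₂ → let x₃ = l :* l :- (β :- α) :- x₁ :- x₂ in
        x₂ := (:- l) :* (:- l) :- (β :- α) :- x₁ :- x₃) refl α β l x₁ x₂)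
      (combine₁ (- 1ℚ) c (solve 7 (λ α β l x₁ y₁ x₂ y₂ →
        let x₃ = l :* l :- (β :- α) :- x₁ :- x₂
        in y₂ := ((:- l) :* (x₁ :- ((:- l) :* (:- l) :- (β :- α) :- x₁ :- x₃)) :- :- y₁)
             :+ (:- con 1ℚ) :* (l :* (x₂ :- x₁) :- (y₂ :- y₁))) refl α β l x₁ y₁ x₂ y₂))

    ⊕-secant⁻¹ : ∀ {x₁ y₁ x₂ y₂ x₃ y₃} .{e₁ : OnCurve x₁ y₁} .{e₂ : OnCurve x₂ y₂} .{e₃ : OnCurve x₃ y₃} →
      aff x₁ y₁ e₁ ⊕ aff x₂ y₂ e₂ ≡ aff x₃ y₃ e₃ →
      ∃[ l ] IsSlope l x₁ y₁ x₂ y₂ × x₃ ≡ sumX l x₁ x₂ × y₃ ≡ sumY l x₁ y₁ x₂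
    ⊕-secant⁻¹ {x₁} {y₁} {x₂} {y₂} {e₁ = e₁} {e₂} eq
      with aff x₁ y₁ e₁ ⊕ aff x₂ y₂ e₂ | ⊕-sum x₁ y₁ x₂ y₂ {e₁} {e₂} | eq
    ... | _ | secant l _ sl | refl = l , sl , refl , refl

  -- Root e a b: e is a root of the cubic, and the other roots are e - a and e - b.
  data Root : ℚ → ℚ → ℚ → Set where
    root₀ : Root 0ℚ (- α) β
    rootα : Root α α (α + β)
    rootβ : Root (- β) (- β) (- β - α)

  -- The curve in coordinates centred at a root.

  module _ {e a b : ℚ} where
    opaque
      cubic-shift : Root e a b → ∀ x → cubic x ≡ (x - e) * ((x - e) + a) * ((x - e) + b)
      cubic-shift root₀ x = solve 3 (λ α β x → x :* (x :- α) :* (x :+ β)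
        := (x :- con 0ℚ) :* ((x :- con 0ℚ) :+ :- α) :* ((x :- con 0ℚ) :+ β)) refl α β x
      cubic-shift rootα x = solve 3 (λ α β x → x :* (x :- α) :* (x :+ β)
        := (x :- α) :* ((x :- α) :+ α) :* ((x :- α) :+ (α :+ β))) refl α β x
      cubic-shift rootβ x = solve 3 (λ α β x → x :* (x :- α) :* (x :+ β)
        := (x :- :- β) :* ((x :- :- β) :+ :- β) :* ((x :- :- β) :+ (:- β :- α))) refl α β x

      sumX-shift : Root e a b → ∀ l x₁ x₂ →
        sumX l x₁ x₂ - e ≡ l * l - (a + b) - (x₁ - e) - (x₂ - e)
      sumX-shift root₀ l x₁ x₂ = solve 5 (λ α β l x₁ x₂ →
        let e = con 0ℚ in l :* l :- (β :- α) :- x₁ :- x₂ :- e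
          := l :* l :- (:- α :+ β) :- (x₁ :- e) :- (x₂ :- e)) refl α β l x₁ x₂
      sumX-shift rootα l x₁ x₂ = solve 5 (λ α β l x₁ x₂ →
        let e = α in l :* l :- (β :- α) :- x₁ :- x₂ :- e
          := l :* l :- (α :+ (α :+ β)) :- (x₁ :- e) :- (x₂ :- e)) refl α β l x₁ x₂
      sumX-shift rootβ l x₁ x₂ = solve 5 (λ α β l x₁ x₂ →
        let e = :- β in l :* l :- (β :- α) :- x₁ :- x₂ :- e
          := l :* l :- (:- β :+ (:- β :- α)) :- (x₁ :- e) :- (x₂ :- e)) refl α β l x₁ x₂

      divided-shift : Root e a b → ∀ x → divided x x ≡ (x - e) * (x - e) + (x - e) * (x - e)
        + (x - e) * (x - e) + (a + b) * ((x - e) + (x - e)) + a * b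
      divided-shift root₀ x = solve 3 (λ α β x →
        let u = x :- con 0ℚ in x :* x :+ x :* x :+ x :* x :+ (β :- α) :* (x :+ x) :- α :* β
          := u :* u :+ u :* u :+ u :* u :+ (:- α :+ β) :* (u :+ u) :+ :- α :* β) refl α β x
      divided-shift rootα x = solve 3 (λ α β x →
        let u = x :- α in x :* x :+ x :* x :+ x :* x :+ (β :- α) :* (x :+ x) :- α :* β
          := u :* u :+ u :* u :+ u :* u :+ (α :+ (α :+ β)) :* (u :+ u) :+ α :* (α :+ β)) refl α β x
      divided-shift rootβ x = solve 3 (λ α β x →
        let u = x :- :- β in x :* x :+ x :* x :+ x :* x :+ (β :- α) :* (x :+ x) :- α :* β
          := u :* u :+ u :* u :+ u :* u :+ (:- β :+ (:- β :- α)) :* (u :+ u) :+ :- β :* (:- β :- α))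
        refl α β x

      -- `Flex` expands to a condition symmetric in its arguments, and each root yields the same
      -- three differences in another order.
      flex-shift : Root e a b → ∀ x → Flex (x - e) ((x - e) + a) ((x - e) + b) →
        Flex (x - 0ℚ) (x - α) (x - - β)
      flex-shift root₀ x flex = combine₁ 1ℚ flex (solve 3 (λ α β x →
        flexL (x :- con 0ℚ) (x :- α) (x :- :- β) := flexR (x :- con 0ℚ) (x :- α) (x :- :- β)
          :+ con 1ℚ :* (flexL (x :- con 0ℚ) ((x :- con 0ℚ) :+ :- α) ((x :- con 0ℚ) :+ β)
                        :- flexR (x :- con 0ℚ) ((x :- con 0ℚ) :+ :- α) ((x :- con 0ℚ) :+ β)))
          refl α β x)
      flex-shift rootα x flex = combine₁ 1ℚ flex (solve 3 (λ α β x →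
        flexL (x :- con 0ℚ) (x :- α) (x :- :- β) := flexR (x :- con 0ℚ) (x :- α) (x :- :- β)
          :+ con 1ℚ :* (flexL (x :- α) ((x :- α) :+ α) ((x :- α) :+ (α :+ β))
                        :- flexR (x :- α) ((x :- α) :+ α) ((x :- α) :+ (α :+ β))))
          refl α β x)
      flex-shift rootβ x flex = combine₁ 1ℚ flex (solve 3 (λ α β x →
        flexL (x :- con 0ℚ) (x :- α) (x :- :- β) := flexR (x :- con 0ℚ) (x :- α) (x :- :- β)
          :+ con 1ℚ :* (flexL (x :- :- β) ((x :- :- β) :+ :- β) ((x :- :- β) :+ (:- β :- α))
                        :- flexR (x :- :- β) ((x :- :- β) :+ :- β) ((x :- :- β) :+ (:- β :- α))))
          refl α β x)

  -- Two-torsion points and the consequences of vanishing multiples.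

  IsTwoTorsion : Point → Set
  IsTwoTorsion P = ∃[ e ] ∃[ a ] ∃[ b ] Root e a b × ∃[ oc ] P ≡ aff e 0ℚ oc

  opaque
    self-opposite⇒twoTorsion : ∀ P → P ≢ O → P ≡ ⊖ P → IsTwoTorsion P
    self-opposite⇒twoTorsion O           P≢O eq = contradiction refl P≢O
    self-opposite⇒twoTorsion (aff x y oc) P≢O eq = root (p*q≡0⇒p≡0⊎q≡0 (x * (x - α)) cubic≡0)
      where
      y≡0 : y ≡ 0ℚ
      y≡0 = p≡-p⇒p≡0 y (proj₂ (aff-injective eq))

      cubic≡0 : cubic x ≡ 0ℚ
      cubic≡0 = trans (sym (onCurve x y oc)) (cong (λ y → y * y) y≡0)

      at : ∀ {e a b} → Root e a b → x ≡ e → IsTwoTorsion (aff x y oc)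
      at r refl = _ , _ , _ , r , sym cubic≡0 , aff-cong refl y≡0

      root : x * (x - α) ≡ 0ℚ ⊎ x + β ≡ 0ℚ → IsTwoTorsion (aff x y oc)
      root (inj₂ h) = at rootβ (p+q≡0⇒p≡-q x β h)
      root (inj₁ h) = [ at root₀ , (λ h → at rootα (p-q≡0⇒p≡q x α h)) ]′ (p*q≡0⇒p≡0⊎q≡0 x h)

  opaque
    affine : ∀ P → P ≢ O → ∃[ x ] ∃[ y ] ∃[ oc ] P ≡ aff x y oc
    affine O            P≢O = contradiction refl P≢O
    affine (aff x y oc) _   = x , y , onCurve x y oc , refl

    2P≢O⇒y≢0 : ∀ x y .(oc : OnCurve x y) → aff x y oc ⊕ aff x y oc ≢ O → y ≢ 0ℚ
    2P≢O⇒y≢0 x y oc 2P≢O y≡0 = 2P≢O (⊕-opposite {x} {y} {x} (refl , trans y≡0 (cong -_ (sym y≡0))))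

  Harmonic : Set
  Harmonic = ∃[ x ] HarmonicRoots (x - 0ℚ) (x - α) (x - - β)

  -- The trace of a rational point Q with 2Q = (e , 0): `v` is its abscissa minus `e`, and `w` is
  -- its ordinate divided by `v`.
  Halved : Set
  Halved = ∃[ e ] ∃[ a ] ∃[ b ] Root e a b × ∃[ v ] ∃[ w ] v * v ≡ a * b × w * w ≡ v + v + a + b

  module _ (x y : ℚ) .(oc : OnCurve x y) (y≢0 : y ≢ 0ℚ) where
    private
      P : Point
      P = aff x y oc

    opaque
      move : ∀ {R S} → P ⊕ R ≡ S → R ≡ ⊖ P ⊕ S
      move {R} eq = trans (sym (⊖-cancelˡ y≢0 R)) (cong (⊖ P ⊕_) eq)

      -- Turns a vanishing multiple 2m P ≡ O into m P ≡ ⊖ (m P) in m steps.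
      step : ∀ {R S} → P ⊕ R ≡ ⊖ S → R ≡ ⊖ (P ⊕ S)
      step {R} {S} eq = trans (move eq) (sym (⊖-distrib-⊕ P S))

      onCurve-shift : ∀ {e a b} → Root e a b → y * y ≡ (x - e) * ((x - e) + a) * ((x - e) + b)
      onCurve-shift r = trans (onCurve x y oc) (cubic-shift r x)

      x-e≢0 : ∀ {e a b} → Root e a b → x - e ≢ 0ℚ
      x-e≢0 {e} {a} {b} r x-e≡0 = y≢0 (p*p≡0⇒p≡0 y (trans (onCurve-shift r)
        (combine₁ (((x - e) + a) * ((x - e) + b)) x-e≡0 (solve 3 (λ u a b →
          u :* (u :+ a) :* (u :+ b) := con 0ℚ :+ ((u :+ a) :* (u :+ b)) :* (u :- con 0ℚ)) refl (x - e) a b))))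

    opaque
      -- The second equation compares slopes at (e , 0) on the line through ⊖ P, (e , 0) and the
      -- reflection of the sum.
      translate : ∀ e {a b} .(oc₀ : OnCurve e 0ℚ) → Root e a b → ∀ x₃ y₃ .(oc₃ : OnCurve x₃ y₃) →
        ⊖ P ⊕ aff e 0ℚ oc₀ ≡ aff x₃ y₃ oc₃ →
        (x₃ - e) * (x - e) ≡ a * b × y₃ * (x - e) ≡ y * (x₃ - e)
      translate e {a} {b} oc₀ r x₃ y₃ oc₃ eq with ⊕-secant⁻¹ eq
      ... | l , isSlope c _ , x₃≡ , y₃≡ =
        translate-x (x - e) (x₃ - e) a b l y (x-e≢0 r) l≡ x₃-e≡ (onCurve-shift r) ,
        combine₂ (x - e) (x - x₃) y₃≡l l≡ (solve 6 (λ l e x y x₃ y₃ →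
          y₃ :* (x :- e) := y :* (x₃ :- e) :+ (x :- e) :* (y₃ :- (l :* (x :- x₃) :+ y))
            :+ (x :- x₃) :* (l :* (x :- e) :- :- y)) refl l e x y x₃ y₃)
        where
        l≡ : l * (x - e) ≡ - y
        l≡ = combine₁ (- 1ℚ) c (solve 4 (λ l e x y → l :* (x :- e) := :- y
          :+ (:- con 1ℚ) :* (l :* (e :- x) :- (con 0ℚ :- :- y))) refl l e x y)

        x₃-e≡ : x₃ - e ≡ l * l - (a + b) - (x - e)
        x₃-e≡ = trans (cong (_- e) x₃≡) (trans (sumX-shift r l x e)
          (solve 4 (λ e k l u → l :* l :- k :- u :- (e :- e) := l :* l :- k :- u) refl e (a + b) l (x - e)))

        y₃≡l : y₃ ≡ l * (x - x₃) + y
        y₃≡l = trans y₃≡ (trans (cong (λ x₃ → l * (x - x₃) - - y) (sym x₃≡))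
          (solve 2 (λ k y → k :- :- y := k :+ y) refl (l * (x - x₃)) y))

    module _ (x₂ y₂ : ℚ) .(oc₂ : OnCurve x₂ y₂) (2P≡ : P ⊕ P ≡ aff x₂ y₂ oc₂) where
      opaque
        doubling : ∀ {e a b} → Root e a b → (x₂ - e) * ((y + y) * (y + y))
          ≡ ((x - e) * (x - e) - a * b) * ((x - e) * (x - e) - a * b)
        doubling {e} {a} {b} r with ⊕-secant⁻¹ 2P≡
        ... | l , isSlope _ t , x₂≡ , _ = doubling-identity (x - e) (x₂ - e) a b l y (trans t (divided-shift r x))
          (trans (cong (_- e) x₂≡) (sumX-shift r l x x)) (onCurve-shift r)

      opaque
        -- The root is ((x - e)² - ab) / 2y, read off the duplication formula.
        doubling-square : ∀ {e a b} → Root e a b → ∃[ p ] x₂ - e ≡ p * p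
        doubling-square {e} {a} {b} r
          with quotient ((x - e) * (x - e) - a * b) (y + y) 2y≢0
          where
          2y≢0 : y + y ≢ 0ℚ
          2y≢0 eq = y≢0 (p≡-p⇒p≡0 y (p+q≡0⇒p≡-q y y eq))
        ... | p , p≡ = p , *-cancelˡ-≢0 ((y + y) * (y + y))
          (λ eq → y≢0 (p≡-p⇒p≡0 y (p+q≡0⇒p≡-q y y (p*p≡0⇒p≡0 (y + y) eq))))
          (combine₂ 1ℚ (- (p * (y + y) + ((x - e) * (x - e) - a * b))) (doubling r) p≡
            (solve 4 (λ v d n p → d :* d :* v := d :* d :* (p :* p) :+ con 1ℚ :* (v :* (d :* d) :- n :* n)
              :+ (:- (p :* d :+ n)) :* (p :* d :- n)) refl (x₂ - e) (y + y) ((x - e) * (x - e) - a * b) p))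

        flex⇒harmonic : ∀ {e a b} → Root e a b → Flex (x₂ - e) ((x₂ - e) + a) ((x₂ - e) + b) →
          HarmonicRoots (x₂ - 0ℚ) (x₂ - α) (x₂ - - β)
        flex⇒harmonic r flex = flex⇒harmonicRoots
          (proj₁ (doubling-square root₀)) (proj₁ (doubling-square rootα)) (proj₁ (doubling-square rootβ))
          (proj₂ (doubling-square root₀)) (proj₂ (doubling-square rootα)) (proj₂ (doubling-square rootβ))
          (flex-shift r x₂ flex)

    3P≡O⇒harmonic : P ⊕ (P ⊕ P) ≡ O → Harmonic
    -- Here 2P = ⊖ P, so the double again has abscissa x.
    3P≡O⇒harmonic 3P≡O = x , flex⇒harmonic x (- y) (neg-onCurve x y oc) (move 3P≡O) root₀
      (triple⇒flex (x - 0ℚ) (- α) β y (onCurve-shift root₀)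
        (doubling x (- y) (neg-onCurve x y oc) (move 3P≡O) root₀))

    -- 3P is its own negative, hence T = (e , 0) for a root e, and cancelling P gives 2P = T - P.
    6P≡O⇒harmonic : P ⊕ (P ⊕ (P ⊕ (P ⊕ (P ⊕ P)))) ≡ O → P ⊕ P ≢ O → P ⊕ (P ⊕ P) ≢ O → Harmonic
    6P≡O⇒harmonic 6P≡O 2P≢O 3P≢O
      with e , a , b , r , oc₀ , 3P≡ ← self-opposite⇒twoTorsion (P ⊕ (P ⊕ P)) 3P≢O
             (step {S = P ⊕ P} (step {S = P} (step {S = O} 6P≡O)))
      with x₂ , y₂ , oc₂ , 2P≡ ← affine (P ⊕ P) 2P≢O
      = x₂ , flex⇒harmonic x₂ y₂ oc₂ 2P≡ r
          (sextuple⇒flex (x - e) (x₂ - e) a b y (x-e≢0 r)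
            (proj₁ (translate e oc₀ r x₂ y₂ oc₂ (trans (sym (move 3P≡)) 2P≡)))
            (onCurve-shift r) (doubling x₂ y₂ oc₂ 2P≡ r))

    -- 2P is some T = (e , 0), so P = T - P and translation by T fixes the abscissa of P.
    4P≡O⇒halved : P ⊕ (P ⊕ (P ⊕ P)) ≡ O → P ⊕ P ≢ O → Halved
    4P≡O⇒halved 4P≡O 2P≢O
      with e , a , b , r , oc₀ , 2P≡ ← self-opposite⇒twoTorsion (P ⊕ P) 2P≢O
             (step {S = P} (step {S = O} 4P≡O))
      with u²≡ab ← proj₁ (translate e oc₀ r x y oc (sym (move 2P≡)))
      with w , w²≡ ← halving-identity (x - e) a b y (x-e≢0 r) u²≡ab (onCurve-shift r)
      = e , a , b , r , x - e , w , u²≡ab , w²≡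

    -- With 4P = T the point halving T is 2P. It is reached by cancelling P alone: 3P = T - P, then
    -- 2P = 3P - P.
    8P≡O⇒halved : P ⊕ (P ⊕ (P ⊕ (P ⊕ (P ⊕ (P ⊕ (P ⊕ P)))))) ≡ O →
      P ⊕ P ≢ O → P ⊕ (P ⊕ P) ≢ O → P ⊕ (P ⊕ (P ⊕ P)) ≢ O → Halved
    8P≡O⇒halved 8P≡O 2P≢O 3P≢O 4P≢O
      with e , a , b , r , oc₀ , 4P≡ ← self-opposite⇒twoTorsion (P ⊕ (P ⊕ (P ⊕ P))) 4P≢O
             (step {S = P ⊕ (P ⊕ P)} (step {S = P ⊕ P} (step {S = P} (step {S = O} 8P≡O))))
      with x₃ , y₃ , oc₃ , 3P≡ ← affine (P ⊕ (P ⊕ P)) 3P≢O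
      with x₂ , y₂ , oc₂ , 2P≡ ← affine (P ⊕ P) 2P≢O
      with wu≡ , y₃u≡ ← translate e oc₀ r x₃ y₃ oc₃ (trans (sym (move 4P≡)) 3P≡)
      with m , isSlope c _ , x₂≡ , _ ← ⊕-secant⁻¹ (trans (sym (move 3P≡)) 2P≡)
      = e , a , b , r , x₂ - e , proj₁ half , v²≡ , proj₂ half
      where
      u≢0 : x - e ≢ 0ℚ
      u≢0 = x-e≢0 r

      -- Equal abscissae would give equal ordinates by `y₃u≡`, so 3P = P and 2P = O.
      u≢w : x - e ≢ x₃ - e
      u≢w eq = 2P≢O (trans (move (trans 3P≡ 3P≡P)) (⊖-inverseˡ P))
        where
        3P≡P : aff x₃ y₃ oc₃ ≡ P
        3P≡P = aff-cong (combine₁ (- 1ℚ) eq (solve 3 (λ e x x₃ → x₃ := x :+ (:- con 1ℚ) :* (x :- e :- (x₃ :- e)))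
            refl e x x₃))
          (*-cancelˡ-≢0 (x - e) u≢0 (trans (*-comm (x - e) y₃) (trans y₃u≡
            (trans (cong (y *_) (sym eq)) (*-comm y (x - e))))))

      m≡ : m * ((x₃ - e) - (x - e)) ≡ y₃ + y
      m≡ = combine₁ 1ℚ c (solve 6 (λ e m x y x₃ y₃ → m :* (x₃ :- e :- (x :- e)) := y₃ :+ y
        :+ con 1ℚ :* (m :* (x₃ :- x) :- (y₃ :- :- y))) refl e m x y x₃ y₃)

      v²≡ : (x₂ - e) * (x₂ - e) ≡ a * b
      v²≡ = octuple-identity (x - e) (x₂ - e) (x₃ - e) a b m y y₃ u≢0 u≢w wu≡ y₃u≡ m≡
        (trans (cong (_- e) x₂≡) (sumX-shift r m x x₃)) (onCurve-shift r) (doubling x₂ y₂ oc₂ 2P≡ r)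

      -- If v = 0, the duplication formula gives u² = ab = uw, contradicting `u≢w`.
      v≢0 : x₂ - e ≢ 0ℚ
      v≢0 v≡0 = u≢w (*-cancelˡ-≢0 (x - e) u≢0 (combine₂ 1ℚ (- 1ℚ)
        (p*p≡0⇒p≡0 ((x - e) * (x - e) - a * b)
          (combine₂ (- 1ℚ) ((y + y) * (y + y)) (doubling x₂ y₂ oc₂ 2P≡ r) v≡0
            (solve 3 (λ v d n → n :* n := con 0ℚ :+ (:- con 1ℚ) :* (v :* d :- n :* n) :+ d :* (v :- con 0ℚ))
              refl (x₂ - e) ((y + y) * (y + y)) ((x - e) * (x - e) - a * b))))
        wu≡ (solve 4 (λ u w a b → u :* u := u :* w :+ con 1ℚ :* (u :* u :- a :* b :- con 0ℚ)
          :+ (:- con 1ℚ) :* (w :* u :- a :* b)) refl (x - e) (x₃ - e) a b)))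

      half : ∃[ w ] w * w ≡ (x₂ - e) + (x₂ - e) + a + b
      half = halving-identity (x₂ - e) a b y₂ v≢0 v²≡ (trans (onCurve x₂ y₂ oc₂) (cubic-shift r x₂))

  -- Points of exact order 3, 6, 4 and 8.

  order3⇒harmonic : HasElementOfOrder rawMonoid 3 → Harmonic
  order3⇒harmonic (O , _ , _ , least) = contradiction refl (least 1 (from-yes (1 ≤? 1)) (from-yes (2 ≤? 3)))
  order3⇒harmonic (aff x y oc , _ , 3P≡O , least) =
    3P≡O⇒harmonic x y oc (2P≢O⇒y≢0 x y oc (least 2 (from-yes (1 ≤? 2)) (from-yes (3 ≤? 3)))) 3P≡O

  order6⇒harmonic : HasElementOfOrder rawMonoid 6 → Harmonic
  order6⇒harmonic (O , _ , _ , least) = contradiction refl (least 1 (from-yes (1 ≤? 1)) (from-yes (2 ≤? 6)))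
  order6⇒harmonic (aff x y oc , _ , 6P≡O , least) =
    6P≡O⇒harmonic x y oc (2P≢O⇒y≢0 x y oc (least 2 (from-yes (1 ≤? 2)) (from-yes (3 ≤? 6)))) 6P≡O
      (least 2 (from-yes (1 ≤? 2)) (from-yes (3 ≤? 6))) (least 3 (from-yes (1 ≤? 3)) (from-yes (4 ≤? 6)))

  order4⇒halved : HasElementOfOrder rawMonoid 4 → Halved
  order4⇒halved (O , _ , _ , least) = contradiction refl (least 1 (from-yes (1 ≤? 1)) (from-yes (2 ≤? 4)))
  order4⇒halved (aff x y oc , _ , 4P≡O , least) =
    4P≡O⇒halved x y oc (2P≢O⇒y≢0 x y oc (least 2 (from-yes (1 ≤? 2)) (from-yes (3 ≤? 4)))) 4P≡O
      (least 2 (from-yes (1 ≤? 2)) (from-yes (3 ≤? 4)))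

  order8⇒halved : HasElementOfOrder rawMonoid 8 → Halved
  order8⇒halved (O , _ , _ , least) = contradiction refl (least 1 (from-yes (1 ≤? 1)) (from-yes (2 ≤? 8)))
  order8⇒halved (aff x y oc , _ , 8P≡O , least) =
    8P≡O⇒halved x y oc (2P≢O⇒y≢0 x y oc (least 2 (from-yes (1 ≤? 2)) (from-yes (3 ≤? 8)))) 8P≡O
      (least 2 (from-yes (1 ≤? 2)) (from-yes (3 ≤? 8))) (least 3 (from-yes (1 ≤? 3)) (from-yes (4 ≤? 8)))
      (least 4 (from-yes (1 ≤? 4)) (from-yes (5 ≤? 8)))

-- Integers inside the rationals, common denominators and signs.

fromℤ : ℤ → ℚ
fromℤ z = z / 1

-- P / D need not be in lowest terms, so several rationals can share one `D`.
record Numerator (D : ℤ) (p : ℚ) (P : ℤ) : Set where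
  constructor numerator
  field numerator-eq : p * fromℤ D ≡ fromℤ P

opaque
  fromℤ≡mkℚ : ∀ z → fromℤ z ≡ mkℚ z 0 (ℕ.sym {1} (ℕ.1-coprimeTo ∣ z ∣))
  fromℤ≡mkℚ z = ↥p/↧p≡p (mkℚ z 0 _)

  fromℤ-injective : ∀ {m n} → fromℤ m ≡ fromℤ n → m ≡ n
  fromℤ-injective {m} {n} eq =
    proj₁ (mkℚ-injective (trans (sym (fromℤ≡mkℚ m)) (trans eq (fromℤ≡mkℚ n))))

  fromℤ-* : ∀ m n → fromℤ (m ℤ.* n) ≡ fromℤ m * fromℤ n
  fromℤ-* m n = sym (cong₂ _*_ (fromℤ≡mkℚ m) (fromℤ≡mkℚ n))

  fromℤ-+ : ∀ m n → fromℤ (m ℤ.+ n) ≡ fromℤ m + fromℤ n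
  fromℤ-+ m n = trans (cong₂ (λ m n → fromℤ (m ℤ.+ n)) (sym (ℤ.*-identityʳ m)) (sym (ℤ.*-identityʳ n)))
    (sym (cong₂ _+_ (fromℤ≡mkℚ m) (fromℤ≡mkℚ n)))

  p*↧p≡↥p : ∀ p → p * fromℤ (↧ p) ≡ fromℤ (↥ p)
  p*↧p≡↥p p@(mkℚ n d c) = trans (cong (p *_) (fromℤ≡mkℚ (↧ p)))
    (fromℚᵘ-cong {mkℚᵘ (n ℤ.* + suc d) (d ℕ.* 1)} {mkℚᵘ n 0}
      (*≡* (trans (ℤ.*-identityʳ _) (cong (λ d → n ℤ.* + suc d) (sym (ℕ.*-identityʳ d))))))

  commonDenominator : ∀ p q t → ∃[ D ] D ≢ 0ℤ × ∃[ P ] ∃[ Q ] ∃[ T ]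
    Numerator D p P × Numerator D q Q × Numerator D t T
  commonDenominator p@record{} q@record{} t@record{} = ↧ p ℤ.* (↧ q ℤ.* ↧ t) , (λ ()) ,
      ↥ p ℤ.* (↧ q ℤ.* ↧ t) , ↥ q ℤ.* (↧ p ℤ.* ↧ t) , ↥ t ℤ.* (↧ p ℤ.* ↧ q) ,
      clear p (↧ q ℤ.* ↧ t) refl ,
      clear q (↧ p ℤ.* ↧ t) (trans (sym (ℤ.*-assoc (↧ p) (↧ q) (↧ t)))
        (trans (cong (ℤ._* ↧ t) (ℤ.*-comm (↧ p) (↧ q))) (ℤ.*-assoc (↧ q) (↧ p) (↧ t)))) ,
      clear t (↧ p ℤ.* ↧ q) (trans (sym (ℤ.*-assoc (↧ p) (↧ q) (↧ t))) (ℤ.*-comm (↧ p ℤ.* ↧ q) (↧ t)))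
    where
    clear : ∀ p {D} d → D ≡ ↧ p ℤ.* d → Numerator D p (↥ p ℤ.* d)
    clear p d refl = numerator (trans (cong (p *_) (fromℤ-* (↧ p) d))
      (trans (sym (*-assoc p (fromℤ (↧ p)) (fromℤ d)))
        (trans (cong (_* fromℤ d) (p*↧p≡↥p p)) (sym (fromℤ-* (↥ p) d)))))

  numerator-+ : ∀ {D p q P Q} → Numerator D p P → Numerator D q Q → Numerator D (p + q) (P ℤ.+ Q)
  numerator-+ {D} {p} {q} {P} {Q} (numerator P≡) (numerator Q≡) = numerator
    (trans (*-distribʳ-+ (fromℤ D) p q) (trans (cong₂ _+_ P≡ Q≡) (sym (fromℤ-+ P Q))))

  numerator-≢0 : ∀ {p D P} → D ≢ 0ℤ → Numerator D p P → p ≢ 0ℚ → P ≢ 0ℤ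
  numerator-≢0 D≢0 (numerator eq) p≢0 refl = p≢0∧q≢0⇒p*q≢0 p≢0 (λ z → D≢0 (fromℤ-injective z)) eq

fromℕ : ℕ → ℚ
fromℕ n = fromℤ (+ n)

opaque
  positive-fromℕ : ∀ n → n ≢ 0 → Positive (fromℕ n)
  positive-fromℕ zero    n≢0 = contradiction refl n≢0
  positive-fromℕ (suc n) _   = subst Positive (sym (fromℤ≡mkℚ +[1+ n ])) _

  square-positive : ∀ p → p ≢ 0ℚ → Positive (p * p)
  square-positive p@(mkℚ +[1+ _ ] _ _) _  = pos*pos⇒pos p p
  square-positive p@(mkℚ -[1+ _ ] _ _) _  = neg*neg⇒pos p p
  square-positive p@(mkℚ (+ 0) _ _) p≢0 = contradiction (↥p≡0⇒p≡0 p refl) p≢0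

  square-nonNegative : ∀ p → NonNegative (p * p)
  square-nonNegative p with p ≟ 0ℚ
  ... | yes refl = _
  ... | no p≢0   = pos⇒nonNeg (p * p) {{square-positive p p≢0}}

  positive⇒≢0 : ∀ p → Positive p → p ≢ 0ℚ
  positive⇒≢0 _ () refl

  -- Otherwise pw² + z² would vanish, although its first term is positive.
  negative*square≢square : ∀ p w z → Positive p → w ≢ 0ℚ → (- p) * (w * w) ≢ z * z
  negative*square≢square p w z pos w≢0 eq = positive⇒≢0 (p * (w * w) + z * z)
    (pos+nonNeg⇒pos (p * (w * w)) {{pos*pos⇒pos p {{pos}} (w * w) {{square-positive w w≢0}}}}
      (z * z) {{square-nonNegative z}})
    (combine₁ (- 1ℚ) eq (solve 3 (λ p w z → p :* (w :* w) :+ z :* z := con 0ℚ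
      :+ (:- con 1ℚ) :* ((:- p) :* (w :* w) :- z :* z)) refl p w z))

-- Consequences of the positivity of α and β.

module _ (α β : ℚ) (α>0 : Positive α) (β>0 : Positive β) where
  open CurveProperties α β

  private
    α≢0 : α ≢ 0ℚ
    α≢0 = positive⇒≢0 α α>0

    α+β≢0 : α + β ≢ 0ℚ
    α+β≢0 = positive⇒≢0 (α + β) (pos+pos⇒pos α {{α>0}} β {{β>0}})

  opaque
    root⇒a≢b : ∀ {e a b} → Root e a b → a ≢ b
    root⇒a≢b root₀ eq = α+β≢0 (combine₁ (- 1ℚ) eq (solve 2 (λ α β →
      α :+ β := con 0ℚ :+ (:- con 1ℚ) :* (:- α :- β)) refl α β))
    root⇒a≢b rootα eq = positive⇒≢0 β β>0 (combine₁ (- 1ℚ) eq (solve 2 (λ α β →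
      β := con 0ℚ :+ (:- con 1ℚ) :* (α :- (α :+ β))) refl α β))
    root⇒a≢b rootβ eq = α≢0 (combine₁ 1ℚ eq (solve 2 (λ α β →
      α := con 0ℚ :+ con 1ℚ :* (:- β :- (:- β :- α))) refl α β))

    -- a w² = (a + v)² and b w² = (b + v)², which rules out negative a.
    halved⇒squares : Halved → ∃[ w ] ∃[ y ] ∃[ z ]
      w ≢ 0ℚ × α * (w * w) ≡ y * y × (α + β) * (w * w) ≡ z * z
    halved⇒squares (e , a , b , r , v , w , v²≡ab , w²≡) = conclude r aw²≡ bw²≡
      where
      aw²≡ : a * (w * w) ≡ (a + v) * (a + v)
      aw²≡ = combine₂ a (- 1ℚ) w²≡ v²≡ab (solve 4 (λ a b v w →
        a :* (w :* w) := (a :+ v) :* (a :+ v) :+ a :* (w :* w :- (v :+ v :+ a :+ b))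
          :+ (:- con 1ℚ) :* (v :* v :- a :* b)) refl a b v w)

      bw²≡ : b * (w * w) ≡ (b + v) * (b + v)
      bw²≡ = combine₂ b (- 1ℚ) w²≡ v²≡ab (solve 4 (λ a b v w →
        b :* (w :* w) := (b :+ v) :* (b :+ v) :+ b :* (w :* w :- (v :+ v :+ a :+ b))
          :+ (:- con 1ℚ) :* (v :* v :- a :* b)) refl a b v w)

      w≢0 : w ≢ 0ℚ
      -- If w = 0, both squares vanish and a = - v = b.
      w≢0 w≡0 = root⇒a≢b r (combine₂ 1ℚ (- 1ℚ) (vanish a aw²≡) (vanish b bw²≡) (solve 3 (λ a b v →
        a := b :+ con 1ℚ :* (a :+ v :- con 0ℚ) :+ (:- con 1ℚ) :* (b :+ v :- con 0ℚ)) refl a b v))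
        where
        vanish : ∀ c → c * (w * w) ≡ (c + v) * (c + v) → c + v ≡ 0ℚ
        vanish c eq = p*p≡0⇒p≡0 (c + v) (combine₂ (- 1ℚ) (c * w) eq w≡0 (solve 3 (λ c v w →
          (c :+ v) :* (c :+ v) := con 0ℚ :+ (:- con 1ℚ) :* (c :* (w :* w) :- (c :+ v) :* (c :+ v))
            :+ (c :* w) :* (w :- con 0ℚ)) refl c v w))

      conclude : ∀ {e a b} → Root e a b → a * (w * w) ≡ (a + v) * (a + v) → b * (w * w) ≡ (b + v) * (b + v) →
        ∃[ w ] ∃[ y ] ∃[ z ] w ≢ 0ℚ × α * (w * w) ≡ y * y × (α + β) * (w * w) ≡ z * z
      conclude root₀ eqa eqb = contradiction eqa (negative*square≢square α w (- α + v) α>0 w≢0)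
      conclude rootα eqa eqb = w , α + v , α + β + v , w≢0 , eqa , eqb
      conclude rootβ eqa eqb = contradiction eqa (negative*square≢square β w (- β + v) β>0 w≢0)

    -- Subtracting the three squares pairwise removes `x` and leaves α and β.
    harmonic⇒differences : Harmonic → ∃[ p ] ∃[ q ] ∃[ t ] q ≢ 0ℚ × q + t ≢ 0ℚ ×
      α + q * q ≡ p * p × β + p * p ≡ t * t × p * q + q * t + t * p ≡ 0ℚ
    harmonic⇒differences (x , p , q , t , p²≡ , q²≡ , t²≡ , h) =
      p , q , t , q≢0 , q+t≢0 , α≡ , β≡ , h
      where
      α≡ : α + q * q ≡ p * p
      α≡ = combine₂ 1ℚ (- 1ℚ) p²≡ q²≡ (solve 4 (λ α x p q → α :+ q :* q := p :* p
        :+ con 1ℚ :* (x :- con 0ℚ :- p :* p) :+ (:- con 1ℚ) :* (x :- α :- q :* q)) refl α x p q)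

      β≡ : β + p * p ≡ t * t
      β≡ = combine₂ (- 1ℚ) 1ℚ p²≡ t²≡ (solve 4 (λ β x p t → β :+ p :* p := t :* t
        :+ (:- con 1ℚ) :* (x :- con 0ℚ :- p :* p) :+ con 1ℚ :* (x :- :- β :- t :* t)) refl β x p t)

      q≢0 : q ≢ 0ℚ
      -- If q = 0, then tp = 0; p = 0 would give α = 0, and t = 0 would give α + β = 0.
      q≢0 q≡0 = [ t≢0 , p≢0 ]′ (p*q≡0⇒p≡0⊎q≡0 t (combine₂ 1ℚ (- (p + t)) h q≡0 (solve 3 (λ p q t →
        t :* p := con 0ℚ :+ con 1ℚ :* (p :* q :+ q :* t :+ t :* p :- con 0ℚ)
          :+ (:- (p :+ t)) :* (q :- con 0ℚ)) refl p q t)))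
        where
        p≢0 : p ≢ 0ℚ
        p≢0 p≡0 = α≢0 (combine₃ 1ℚ (- q) p α≡ q≡0 p≡0 (solve 3 (λ α p q →
          α := con 0ℚ :+ con 1ℚ :* (α :+ q :* q :- p :* p) :+ (:- q) :* (q :- con 0ℚ)
            :+ p :* (p :- con 0ℚ)) refl α p q))

        t≢0 : t ≢ 0ℚ
        t≢0 t≡0 = α+β≢0 (combine₂ 1ℚ t (cong₂ _+_ α≡ β≡) t≡0 (combine₁ (- q) q≡0 (solve 5 (λ α β p q t →
          α :+ β := con 0ℚ :+ con 1ℚ :* (α :+ q :* q :+ (β :+ p :* p) :- (p :* p :+ t :* t))
            :+ t :* (t :- con 0ℚ) :+ (:- q) :* (q :- con 0ℚ)) refl α β p q t)))

      q+t≢0 : q + t ≢ 0ℚ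
      -- With t = - q the harmonic relation reduces to - q² = 0.
      q+t≢0 s≡0 = q≢0 (p*p≡0⇒p≡0 q (combine₂ (- 1ℚ) (p + q) h s≡0 (solve 3 (λ p q t →
        q :* q := con 0ℚ :+ (:- con 1ℚ) :* (p :* q :+ q :* t :+ t :* p :- con 0ℚ)
          :+ (p :+ q) :* (q :+ t :- con 0ℚ)) refl p q t)))

-- Transfer of the rational equations to integers by multiplying with D².

opaque
  square-transfer : ∀ n {w y D W Y} → Numerator D w W → Numerator D y Y →
    fromℕ n * (w * w) ≡ y * y → ∣ W ∣ ℕ.* ∣ W ∣ ℕ.* n ≡ ∣ Y ∣ ℕ.* ∣ Y ∣
  square-transfer n {w} {y} {D} {W} {Y} (numerator W≡) (numerator Y≡) eq = trans
      (sym (trans (ℤ.abs-* (W ℤ.* W) (+ n)) (cong (ℕ._* n) (ℤ.abs-* W W))))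
      (trans (cong ∣_∣ WWn≡YY) (ℤ.abs-* Y Y))
    where
    goal : fromℤ (W ℤ.* W ℤ.* + n) ≡ fromℤ (Y ℤ.* Y)
    goal rewrite fromℤ-* (W ℤ.* W) (+ n) | fromℤ-* W W | fromℤ-* Y Y | sym W≡ | sym Y≡ =
      combine₁ (fromℤ D * fromℤ D) eq (solve 4 (λ n w y d →
        w :* d :* (w :* d) :* n := y :* d :* (y :* d) :+ (d :* d) :* (n :* (w :* w) :- y :* y))
        refl (fromℕ n) w y (fromℤ D))

    WWn≡YY : W ℤ.* W ℤ.* + n ≡ Y ℤ.* Y
    WWn≡YY = fromℤ-injective goal

  difference-transfer : ∀ n {p q D P Q} → Numerator D p P → Numerator D q Q →
    fromℕ n + q * q ≡ p * p → D ℤ.* D ℤ.* + n ℤ.+ Q ℤ.* Q ≡ P ℤ.* P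
  difference-transfer n {p} {q} {D} {P} {Q} (numerator P≡) (numerator Q≡) eq = fromℤ-injective goal
    where
    goal : fromℤ (D ℤ.* D ℤ.* + n ℤ.+ Q ℤ.* Q) ≡ fromℤ (P ℤ.* P)
    goal rewrite fromℤ-+ (D ℤ.* D ℤ.* + n) (Q ℤ.* Q) | fromℤ-* (D ℤ.* D) (+ n) | fromℤ-* D D
      | fromℤ-* Q Q | fromℤ-* P P | sym P≡ | sym Q≡ =
      combine₁ (fromℤ D * fromℤ D) eq (solve 4 (λ n p q d →
        d :* d :* n :+ q :* d :* (q :* d) := p :* d :* (p :* d) :+ (d :* d) :* (n :+ q :* q :- p :* p))
        refl (fromℕ n) p q (fromℤ D))

  harmonic-transfer : ∀ {p q t D P Q T} → Numerator D p P → Numerator D q Q →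
    Numerator D t T → p * q + q * t + t * p ≡ 0ℚ → P ℤ.* Q ℤ.+ Q ℤ.* T ℤ.+ T ℤ.* P ≡ 0ℤ
  harmonic-transfer {p} {q} {t} {D} {P} {Q} {T} (numerator P≡) (numerator Q≡) (numerator T≡) eq = fromℤ-injective goal
    where
    goal : fromℤ (P ℤ.* Q ℤ.+ Q ℤ.* T ℤ.+ T ℤ.* P) ≡ 0ℚ
    goal rewrite fromℤ-+ (P ℤ.* Q ℤ.+ Q ℤ.* T) (T ℤ.* P) | fromℤ-+ (P ℤ.* Q) (Q ℤ.* T)
      | fromℤ-* P Q | fromℤ-* Q T | fromℤ-* T P | sym P≡ | sym Q≡ | sym T≡ =
      combine₁ (fromℤ D * fromℤ D) eq (solve 4 (λ p q t d →
        p :* d :* (q :* d) :+ q :* d :* (t :* d) :+ t :* d :* (p :* d) := con 0ℚ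
          :+ (d :* d) :* (p :* q :+ q :* t :+ t :* p :- con 0ℚ)) refl p q t (fromℤ D))

-- Divisibility of 2 and 6 by k.

module _ (A B k : ℕ) (A≢0 : A ≢ 0) (B≢0 : B ≢ 0) (sf : Squarefree k)
         (common∣2 : ∀ {d} → d ℕ.∣ A → d ℕ.∣ B → d ℕ.∣ 2) where
  private
    α β : ℚ
    α = fromℕ (A ℕ.* k)
    β = fromℕ (B ℕ.* k)

    positive-multiple : ∀ n → n ≢ 0 → Positive (fromℕ (n ℕ.* k))
    positive-multiple n n≢0 = positive-fromℕ (n ℕ.* k)
      (λ eq → [ n≢0 , squarefree⇒≢0 sf ]′ (ℕ.m*n≡0⇒m≡0∨n≡0 n eq))

  open CurveProperties α β using (Halved; Harmonic)

  halved⇒∣2 : Halved → k ℕ.∣ 2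
  halved⇒∣2 halved
    with w , y , z , w≢0 , y²≡ , z²≡ ← halved⇒squares α β
           (positive-multiple A A≢0) (positive-multiple B B≢0) halved
    with D , D≢0 , W , Y , Z , W≡ , Y≡ , Z≡ ← commonDenominator w y z
    = squares⇒∣2 {k} {A} {A ℕ.+ B} {∣ W ∣} {∣ Y ∣} {∣ Z ∣} sf
        (λ eq → numerator-≢0 D≢0 W≡ w≢0 (ℤ.∣i∣≡0⇒i≡0 eq))
        (λ eq → numerator-≢0 D≢0 Y≡ y≢0 (ℤ.∣i∣≡0⇒i≡0 eq))
        gcd∣2
        (square-transfer (A ℕ.* k) W≡ Y≡ y²≡)
        (square-transfer ((A ℕ.+ B) ℕ.* k) W≡ Z≡ (trans (cong (_* (w * w)) α+β≡) z²≡))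
    where
    y≢0 : y ≢ 0ℚ
    y≢0 refl = p≢0∧q≢0⇒p*q≢0 (positive⇒≢0 α (positive-multiple A A≢0)) (p≢0∧q≢0⇒p*q≢0 w≢0 w≢0) y²≡

    α+β≡ : fromℕ ((A ℕ.+ B) ℕ.* k) ≡ α + β
    α+β≡ = trans (cong fromℕ (ℕ.*-distribʳ-+ k A B)) (fromℤ-+ (+ (A ℕ.* k)) (+ (B ℕ.* k)))

    -- A divisor of A and A + B also divides B.
    gcd∣2 : ℕ.gcd A (A ℕ.+ B) ℕ.∣ 2
    gcd∣2 = common∣2 (ℕ.gcd[m,n]∣m A (A ℕ.+ B))
      (ℕ.∣m+n∣m⇒∣n (ℕ.gcd[m,n]∣n A (A ℕ.+ B)) (ℕ.gcd[m,n]∣m A (A ℕ.+ B)))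

  harmonic⇒k∣6 : Harmonic → k ℕ.∣ 6
  harmonic⇒k∣6 harmonic
    with p , q , t , q≢0 , q+t≢0 , α≡ , β≡ , h ← harmonic⇒differences α β
           (positive-multiple A A≢0) (positive-multiple B B≢0) harmonic
    with D , D≢0 , P , Q , T , P≡ , Q≡ , T≡ ← commonDenominator p q t
    = harmonic⇒∣6 {k} {A} {B} {D} {P} {Q} {T} sf
        (common∣2 (ℕ.gcd[m,n]∣m A B) (ℕ.gcd[m,n]∣n A B)) D≢0 (numerator-≢0 D≢0 Q≡ q≢0)
        (numerator-≢0 D≢0 (numerator-+ Q≡ T≡) q+t≢0)
        (difference-transfer (A ℕ.* k) P≡ Q≡ α≡) (difference-transfer (B ℕ.* k) T≡ P≡ β≡)
        (harmonic-transfer P≡ Q≡ T≡ h)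

theorem4p2 : (r : ℤ) (s k : ℕ) → Coprime r (+ s) → ∣ r ∣ < s → Squarefree k →
    (¬ (2 ∣ k) → HasElementOfOrder (E⟨ℚ⟩ r s k) 4 ⊎ HasElementOfOrder (E⟨ℚ⟩ r s k) 8 → k ≡ 1)
    × (2 ∣ k → HasElementOfOrder (E⟨ℚ⟩ r s k) 4 ⊎ HasElementOfOrder (E⟨ℚ⟩ r s k) 8 → k ≡ 2)
    × (¬ (2 ∣ k) → HasElementOfOrder (E⟨ℚ⟩ r s k) 3 ⊎ HasElementOfOrder (E⟨ℚ⟩ r s k) 6 → k ≡ 1 ⊎ k ≡ 3)
    × (2 ∣ k → HasElementOfOrder (E⟨ℚ⟩ r s k) 3 ⊎ HasElementOfOrder (E⟨ℚ⟩ r s k) 6 → k ≡ 2 ⊎ k ≡ 6)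
theorem4p2 r s k r⊥s ∣r∣<s sf
  -- As |r| < s, both s - r and s + r are positive and can be replaced by naturals A and B.
  with A , A≢0 , s-r≡A ← positive-sum (ℤ.- r) s (subst (_< s) (sym (ℤ.∣-i∣≡∣i∣ r)) ∣r∣<s)
  with B , B≢0 , s+r≡B ← positive-sum r s ∣r∣<s
  = (λ odd → odd-divisor-2 odd ∘ quartic)
  , (λ even → even-divisor-2 even ∘ quartic)
  , (λ odd → odd-divisor-6 odd ∘ cubic)
  , (λ even → even-divisor-6 even ∘ cubic)
  where
  open CurveProperties

  α≡ : fromℤ ((+ s ℤ.- r) ℤ.* + k) ≡ fromℕ (A ℕ.* k)
  α≡ = cong fromℤ (trans (cong (ℤ._* + k) s-r≡A) (sym (ℤ.pos-* A k)))

  β≡ : fromℤ ((+ s ℤ.+ r) ℤ.* + k) ≡ fromℕ (B ℕ.* k)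
  β≡ = cong fromℤ (trans (cong (ℤ._* + k) s+r≡B) (sym (ℤ.pos-* B k)))

  common∣2 : ∀ {d} → d ∣ A → d ∣ B → d ∣ 2
  common∣2 = ∣s∓r⇒∣2 r s r⊥s s-r≡A s+r≡B

  quartic : HasElementOfOrder (E⟨ℚ⟩ r s k) 4 ⊎ HasElementOfOrder (E⟨ℚ⟩ r s k) 8 → k ∣ 2
  quartic h = halved⇒∣2 A B k A≢0 B≢0 sf common∣2
    (subst₂ Halved α≡ β≡ ([ order4⇒halved _ _ , order8⇒halved _ _ ]′ h))

  cubic : HasElementOfOrder (E⟨ℚ⟩ r s k) 3 ⊎ HasElementOfOrder (E⟨ℚ⟩ r s k) 6 → k ∣ 6
  cubic h = harmonic⇒k∣6 A B k A≢0 B≢0 sf common∣2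
    (subst₂ Harmonic α≡ β≡ ([ order3⇒harmonic _ _ , order6⇒harmonic _ _ ]′ h))
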